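{- For any graph $G$ and any non-negative integer $k$, $$(2k)\text{ -rank-integrity}(G)\ \le\ k\text{ -ancilla-integrity}(|G\rangle)\ \le\ k\text{ -rank-integrity}(G).$$
   Context: Graphs are finite, simple and undirected. The size of a component is its number of vertices. Rank integrity: for graphs $G,G'$ on the same vertex set $V$, $G+G'$ is the graph on $V$ whose edge set is the symmetric difference of the edge sets of $G$ and $G'$. The minimum rank of a graph is the minimum, over all ways of filling in the diagonal of its adjacency matrix with $0$s and $1$s, of the rank of the resulting matrix over $\mathrm{GF}(2)$. The $k$-rank-integrity of $G$ is the minimum, over all graphs $G'$ on $V(G)$ such that $G+G'$ has minimum rank at most $k$, of the maximum component size of $G'$. Ancilla integrity: for a graph $G$ on vertex set $V$, the graph state on the qubit set $V$ is (up to normalization) $|G\rangle=\sum_{X\subseteq V}(-1)^{e_X}|1\rangle_X|0\rangle_{V\setminus X}$, where $e_X$ is the number of edges of $G$ induced by $X$. For graphs $G,G'$ on the same vertex set $V$, $d(|G\rangle,|G'\rangle)$ is the minimum of $|A|$ over all graph states $|\widehat G\rangle$ on a disjoint union $V\cup A$ from which each of $|G\rangle$ and $|G'\rangle$ can be prepared deterministically using only one-qubit Clifford gates, (destructive) one-qubit Pauli measurements, and classical communication. It is known that a graph $H$ is a vertex-minor of a graph $\widehat G$ if and only if $|\widehat G\rangle$ can be transformed deterministically into $|H\rangle$ by such operations; here locally complementing at a vertex $v$ replaces the induced subgraph on the neighborhood of $v$ by its complement, and the vertex-minors of a graph are the graphs obtained from it by vertex deletions and local complementations. So, equivalently, $d(|G\rangle,|G'\rangle)$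 is the minimum $k$ such that some graph with vertex set consisting of $V$ and $k$ additional vertices contains both $G$ and $G'$ as vertex-minors. The $k$-ancilla-integrity of $|G\rangle$ is the minimum, over all graphs $G'$ on $V(G)$ with $d(|G\rangle,|G'\rangle)\le k$, of the maximum component size of $G'$. -}

module Defs where

open import Algebra.Bundles using (module CommutativeRing)
open import Data.Bool.Base using (Bool; true; false; _∧_; _xor_; not; if_then_else_)
open import Data.Bool.Properties using (xor-∧-commutativeRing; ∧-comm)
open import Data.Fin.Base using (Fin; punchIn; _↑ˡ_)
open import Data.Fin.Properties using (_≟_)
open import Data.Fin.Subset using (Subset; _∈_; _∉_; ∣_∣)
open import Data.Nat.Base using (ℕ; suc; _+_; _≤_)
open import Data.Product.Base using (∃; ∃-syntax; _×_)
open import Data.Sum.Base using (_⊎_)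
open import Function.Bundles using (_⇔_; mk⇔)
open import Relation.Binary.Construct.Closure.ReflexiveTransitive using (Star)
open import Relation.Binary.PropositionalEquality using (_≡_; refl; sym; cong₂)
open import Relation.Nullary.Decidable using (does; does-⇔; dec-true)

import Algebra.Properties.Monoid.Sum as MonoidSum

IsMinimum : (ℕ → Set) → ℕ → Set
IsMinimum P m = P m × (∀ j → P j → m ≤ j)

-- The maximum of P ∪ {0}: it is the maximum of P when P is inhabited, and
-- 0 when P is empty.
IsMaximum : (ℕ → Set) → ℕ → Set
IsMaximum P m = (P m ⊎ m ≡ 0) × (∀ j → P j → j ≤ m)

record Graph (n : ℕ) : Set where
  field
    adj     : Fin n → Fin n → Bool
    adj-sym : ∀ x y → adj x y ≡ adj y x
    irrefl  : ∀ x → adj x x ≡ false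

open Graph public

infixl 6 _⊕_

_⊕_ : ∀ {n} → Graph n → Graph n → Graph n
(G ⊕ G′) .adj x y     = adj G x y xor adj G′ x y
(G ⊕ G′) .adj-sym x y = cong₂ _xor_ (adj-sym G x y) (adj-sym G′ x y)
(G ⊕ G′) .irrefl x    = cong₂ _xor_ (irrefl G x) (irrefl G′ x)

Connected : ∀ {n} → Graph n → Fin n → Fin n → Set
Connected G = Star (λ x y → adj G x y ≡ true)

IsComponent : ∀ {n} → Graph n → Subset n → Set
IsComponent G C = ∃[ v ] (∀ u → u ∈ C ⇔ Connected G v u)

IsMaxComponentSize : ∀ {n} → Graph n → ℕ → Set
IsMaxComponentSize G = IsMaximum (λ s → ∃[ C ] (IsComponent G C × ∣ C ∣ ≡ s))

-- GF(2) is Bool with addition _xor_ and multiplication _∧_.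
Matrix : ℕ → ℕ → Set
Matrix m n = Fin m → Fin n → Bool

open MonoidSum (CommutativeRing.+-monoid xor-∧-commutativeRing) public
  using (sum)

IndependentColumns : ∀ {m n} → Matrix m n → Subset n → Set
IndependentColumns {n = n} M S =
  (c : Fin n → Bool) → (∀ j → j ∉ S → c j ≡ false) →
  (∀ i → sum (λ j → c j ∧ M i j) ≡ false) → ∀ j → c j ≡ false

IsRank : ∀ {m n} → Matrix m n → ℕ → Set
IsRank M = IsMaximum (λ r → ∃[ S ] (IndependentColumns M S × ∣ S ∣ ≡ r))

fillDiagonal : ∀ {n} → Graph n → (Fin n → Bool) → Matrix n n
fillDiagonal G d x y = if does (x ≟ y) then d x else adj G x y

IsMinimumRank : ∀ {n} → Graph n → ℕ → Set
IsMinimumRank G = IsMinimum (λ r → ∃[ d ] IsRank (fillDiagonal G d) r)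

IsRankIntegrity : ∀ {n} → ℕ → Graph n → ℕ → Set
IsRankIntegrity {n} k G = IsMinimum λ s →
  ∃ λ (G′ : Graph n) →
    (∃[ r ] (IsMinimumRank (G ⊕ G′) r × r ≤ k)) × IsMaxComponentSize G′ s

localComplement : ∀ {n} → Graph n → Fin n → Graph n
localComplement G v .adj x y =
  adj G x y xor (not (does (x ≟ y)) ∧ (adj G v x ∧ adj G v y))
localComplement G v .adj-sym x y
  rewrite adj-sym G x y
        | does-⇔ (mk⇔ sym sym) (x ≟ y) (y ≟ x)
        | ∧-comm (adj G v x) (adj G v y) = refl
localComplement G v .irrefl x rewrite irrefl G x | dec-true (x ≟ x) refl = refl

-- punchIn v : Fin n → Fin (suc n) enumerates, in order, the vertices
-- other than v.
deleteVertex : ∀ {n} → Graph (suc n) → Fin (suc n) → Graph n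
deleteVertex G v .adj x y     = adj G (punchIn v x) (punchIn v y)
deleteVertex G v .adj-sym x y = adj-sym G (punchIn v x) (punchIn v y)
deleteVertex G v .irrefl x    = irrefl G (punchIn v x)

-- Vertex-minors are labelled: VertexMinor H ι G says that H is obtained from
-- G by local complementations and vertex deletions, the vertex x of H being
-- the surviving vertex ι x of G.
data VertexMinor {m} (H : Graph m) :
       ∀ {n} → (Fin m → Fin n) → Graph n → Set where

  same   : ∀ {G : Graph m} {ι} →
           (∀ x → ι x ≡ x) → (∀ x y → adj G x y ≡ adj H x y) →
           VertexMinor H ι G

  local  : ∀ {n} {G : Graph n} {ι} (v : Fin n) →
           VertexMinor H ι (localComplement G v) → VertexMinor H ι G

  delete : ∀ {n} {G : Graph (suc n)} {ι} (v : Fin (suc n)) (ι′ : Fin m → Fin n) →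
           (∀ x → ι x ≡ punchIn v (ι′ x)) →
           VertexMinor H ι′ (deleteVertex G v) → VertexMinor H ι G

-- The distance d(|G⟩,|G′⟩) between graph states.  A graph state |Ĝ⟩ can be
-- transformed deterministically into |H⟩ by one-qubit Clifford gates,
-- one-qubit Pauli measurements and classical communication if and only if
-- H is a vertex-minor of Ĝ; the distance is expressed through vertex-minors.
-- The vertices of Ĝ are those of V = Fin n, embedded by _↑ˡ k, and k ancillas.
IsAncillaDistance : ∀ {n} → Graph n → Graph n → ℕ → Set
IsAncillaDistance {n} G G′ = IsMinimum λ k →
  ∃ λ (Ĝ : Graph (n + k)) →
    VertexMinor G (_↑ˡ k) Ĝ × VertexMinor G′ (_↑ˡ k) Ĝ

IsAncillaIntegrity : ∀ {n} → ℕ → Graph n → ℕ → Set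
IsAncillaIntegrity {n} k G = IsMinimum λ s →
  ∃ λ (G′ : Graph n) →
    (∃[ d ] (IsAncillaDistance G G′ d × d ≤ k)) × IsMaxComponentSize G′ s

{-# OPTIONS --safe #-}
module Submission where

-- The first inequality: if G and G′ are vertex-minors of one graph, then they
-- are the subgraphs induced by V in two locally equivalent graphs L and L′.
-- Deleting an ancilla from L′ is a measurement in the basis Z, hence a
-- measurement of L in one of the three Pauli bases, i.e. a deletion preceded
-- by at most two local complementations.  These change the graph by a
-- symmetric matrix of rank at most two, up to the diagonal.  The graph
-- obtained from G in this way is locally equivalent to G′, so it has the same
-- components.
--
-- The second inequality: symmetric elimination of a matrix of rank r writes
-- it as a sum of squares wwᵀ and hyperbolic planes uvᵀ + vuᵀ, of total rank
-- r.  A square is realized by one ancilla adjacent to w, a hyperbolic plane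
-- by a pair of adjacent ancillas.
--
-- The three integrities exist constructively since every notion involved is
-- decidable by exhaustive search.

open import Defs
open import Algebra.Bundles using (module CommutativeRing)
open import Data.Bool.Base using (Bool; true; false; _∧_; _∨_; _xor_; not; if_then_else_)
open import Data.Bool.Properties
  using (∧-assoc; ∧-comm; ∧-idem; ∧-identityʳ; ∧-zeroʳ;
         xor-∧-commutativeRing; xor-same; xor-identityʳ; xor-assoc; ¬-not)
import Data.Bool.Properties as Bool
open import Data.Bool.Solver using (module xor-∧-Solver)
open import Data.Fin.Base
  using (Fin; zero; suc; toℕ; fromℕ; punchIn; punchOut; _↑ˡ_; combine; remQuot; funToFin; finToFun)
open import Data.Fin.Properties
  using (_≟_; any?; all?; 2↔Bool; finToFun-funToFin; remQuot-combine; toℕ-injective; toℕ-↑ˡ;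
         punchInᵢ≢i; punchIn-injective; punchIn-punchOut)
open import Data.Fin.Subset using (Subset; _∈_; _∉_; ∣_∣; inside; outside; ⊥)
open import Data.Fin.Subset.Properties
  using (anySubset?; ∣p∣≤n; _∈?_; p⊆q⇒∣p∣≤∣q∣; nonempty?; Empty-unique; ∣⊥∣≡0; ∉⊥)
open import Data.List.Base using (List; []; _∷_; allFin)
open import Data.List.Membership.Propositional using () renaming (_∈_ to _∈ˡ_)
open import Data.List.Membership.Propositional.Properties using (∈-allFin)
open import Data.List.Relation.Unary.Any using (here; there)
open import Data.Nat.Base using (ℕ; zero; suc; _+_; _*_; _^_; _≤_; _<_; z≤n; s≤s)
open import Data.Nat.Properties as ℕ
  using (≤-pred; ≤-trans; ≤-antisym; <⇒≤; ≮⇒≥; n<1+n; m<n⇒m<1+n; m<1+n⇒m<n∨m≡n; m≤n⇒m<n∨m≡n; +-comm)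
open import Data.Product.Base using (∃; ∃₂; ∃-syntax; _×_; _,_; proj₁; proj₂; uncurry)
open import Data.Sum.Base using (_⊎_; inj₁; inj₂)
open import Data.Vec.Base using (tabulate; lookup; _[_]≔_; _∷_)
open import Data.Vec.Functional using (insertAt) renaming (_∷_ to _∷ᵛ_)
open import Data.Vec.Functional.Properties using (insertAt-lookup; insertAt-punchIn)
open import Data.Vec.Properties
  using (lookup∘tabulate; []=⇒lookup; lookup⇒[]=; []≔-lookup; lookup∘update; lookup∘update′)
open import Function.Base using (_∘_)
open import Function.Bundles using (Equivalence; Inverse; _⇔_; _↔_; mk⇔; mk↔ₛ′)
open import Function.Properties.Inverse using (↔-refl; ↔-sym; ↔-trans)
open import Relation.Binary.Construct.Closure.ReflexiveTransitive using (Star; ε; _◅_; _◅◅_)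
open import Relation.Binary.PropositionalEquality
  using (_≡_; _≢_; _≗_; refl; sym; trans; cong; cong₂; cong-app; subst; module ≡-Reasoning)
open import Relation.Nullary using (¬_; Dec; yes; no; contradiction)
open import Relation.Nullary.Decidable
  using (does; map′; _×-dec_; _⊎-dec_; _→-dec_; ¬?; dec-true; dec-false; does-⇔)

import Algebra.Properties.CommutativeMonoid.Sum as CommutativeMonoidSum
import Algebra.Properties.Semiring.Sum as SemiringSum

open CommutativeMonoidSum (CommutativeRing.+-commutativeMonoid xor-∧-commutativeRing)
  using (sum-cong-≗; sum-replicate-zero; sum-remove; ∑-distrib-+; ∑-comm)
open SemiringSum (CommutativeRing.semiring xor-∧-commutativeRing) using (*-distribˡ-sum)

-- Minima and maxima of decidable predicates

search< : ∀ {P : ℕ → Set} → (∀ j → Dec (P j)) → ∀ b →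
          (∃[ m ] (IsMinimum P m × m < b)) ⊎ (∀ j → j < b → ¬ P j)
search< P? zero = inj₂ λ _ ()
search< P? (suc b) with search< P? b
... | inj₁ (m , min , m<b) = inj₁ (m , min , m<n⇒m<1+n m<b)
... | inj₂ none with P? b
...   | yes p = inj₁ (b , (p , λ j pj → ≮⇒≥ λ j<b → none j j<b pj) , n<1+n b)
...   | no ¬p = inj₂ λ j j<1+b pj → case-last (m<1+n⇒m<n∨m≡n j<1+b) pj
  where
  case-last : ∀ {j} → j < b ⊎ j ≡ b → ¬ _
  case-last (inj₁ j<b)  = none _ j<b
  case-last (inj₂ refl) = ¬p

minimum : ∀ {P : ℕ → Set} → (∀ j → Dec (P j)) → ∀ {b} → P b →
          ∃[ m ] (IsMinimum P m × m ≤ b)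
minimum P? {b} p with search< P? (suc b)
... | inj₁ (m , min , m<1+b) = m , min , ≤-pred m<1+b
... | inj₂ none = contradiction p (none b (n<1+n b))

minimum≤? : ∀ {P : ℕ → Set} → (∀ j → Dec (P j)) → ∀ k →
            Dec (∃[ m ] (IsMinimum P m × m ≤ k))
minimum≤? P? k with search< P? (suc k)
... | inj₁ (m , min , m<1+k) = yes (m , min , ≤-pred m<1+k)
... | inj₂ none = no λ (m , (p , _) , m≤k) → none m (s≤s m≤k) p

IsMinimum-cong : ∀ {P Q : ℕ → Set} → (∀ j → P j → Q j) → (∀ j → Q j → P j) →
                 ∀ {m} → IsMinimum P m → IsMinimum Q m
IsMinimum-cong P⇒Q Q⇒P (p , min) = P⇒Q _ p , λ j q → min j (Q⇒P j q)

maximum : ∀ {P : ℕ → Set} → (∀ j → Dec (P j)) → ∀ b → (∀ j → P j → j ≤ b) →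
          ∃ (IsMaximum P)
-- At bound 0 no test of `P 0` is made, since `IsMaximum` accepts 0 as a default value.
maximum P? zero    bound = 0 , inj₂ refl , bound
maximum {P} P? (suc b) bound with P? (suc b)
... | yes p = suc b , inj₁ p , bound
... | no ¬p = maximum P? b λ j pj → bound′ pj (m≤n⇒m<n∨m≡n (bound j pj))
  where
  bound′ : ∀ {j} → P j → j < suc b ⊎ j ≡ suc b → j ≤ b
  bound′ pj (inj₁ j<1+b) = ≤-pred j<1+b
  bound′ pj (inj₂ refl)  = contradiction pj ¬p

IsMaximum-≤ : ∀ {P : ℕ → Set} {m b} → IsMaximum P m → (∀ j → P j → j ≤ b) → m ≤ b
IsMaximum-≤ (inj₁ p    , _) bound = bound _ p
IsMaximum-≤ (inj₂ refl , _) bound = z≤n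

IsMaximum-unique : ∀ {P : ℕ → Set} {m m′} → IsMaximum P m → IsMaximum P m′ → m ≡ m′
IsMaximum-unique max max′ =
  ≤-antisym (IsMaximum-≤ max (proj₂ max′)) (IsMaximum-≤ max′ (proj₂ max))

IsMaximum? : ∀ {P : ℕ → Set} → (∀ j → Dec (P j)) → ∀ b → (∀ j → P j → j ≤ b) →
             ∀ m → Dec (IsMaximum P m)
IsMaximum? P? b bound m with maximum P? b bound
... | m′ , max′ = map′ (λ { refl → max′ }) (λ max → IsMaximum-unique max max′) (m ℕ.≟ m′)

IsMaximum-cong : ∀ {P Q : ℕ → Set} → (∀ j → P j → Q j) → (∀ j → Q j → P j) →
                 ∀ {m} → IsMaximum P m → IsMaximum Q m
IsMaximum-cong P⇒Q Q⇒P (inj₁ p , max) = inj₁ (P⇒Q _ p) , λ j q → max j (Q⇒P j q)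
IsMaximum-cong P⇒Q Q⇒P (inj₂ z , max) = inj₂ z , λ j q → max j (Q⇒P j q)

-- Exhaustive search over Boolean functions and graphs

decodeFunction : ∀ {n} → Fin (2 ^ n) → Fin n → Bool
decodeFunction c x = Inverse.to 2↔Bool (finToFun c x)

encodeFunction : ∀ {n} → (Fin n → Bool) → Fin (2 ^ n)
encodeFunction f = funToFin (λ x → Inverse.from 2↔Bool (f x))

decode-encodeFunction : ∀ {n} (f : Fin n → Bool) → decodeFunction (encodeFunction f) ≗ f
decode-encodeFunction f x = trans
  (cong (Inverse.to 2↔Bool) (finToFun-funToFin (λ y → Inverse.from 2↔Bool (f y)) x))
  (Inverse.strictlyInverseˡ 2↔Bool (f x))

module _ {n} {P : (Fin n → Bool) → Set}
         (resp : ∀ {f g} → f ≗ g → P f → P g) (P? : ∀ f → Dec (P f)) where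

  -- The search runs over the `2 ^ n` codes. Decoding the code of a function returns it only up to
  -- pointwise equality, hence the hypothesis `resp`.
  anyFunction? : Dec (∃ P)
  anyFunction? = map′
    (λ (c , p) → decodeFunction c , p)
    (λ (f , p) → encodeFunction f , resp (λ x → sym (decode-encodeFunction f x)) p)
    (any? λ c → P? (decodeFunction c))

  allFunction? : Dec (∀ f → P f)
  allFunction? = map′
    (λ p f → resp (decode-encodeFunction f) (p (encodeFunction f)))
    (λ p c → p (decodeFunction c))
    (all? λ c → P? (decodeFunction c))

infix 4 _≈_

-- Propositional equality would also compare the proof fields and need extensionality. A record
-- type, unlike the bare function type, lets `G` and `H` be inferred.
record _≈_ {n} (G H : Graph n) : Set where
  constructor pointwise
  field adj≡ : ∀ x y → adj G x y ≡ adj H x y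

open _≈_

≈-refl : ∀ {n} {G : Graph n} → G ≈ G
≈-refl = pointwise λ _ _ → refl

≈-sym : ∀ {n} {G H : Graph n} → G ≈ H → H ≈ G
≈-sym e = pointwise λ x y → sym (adj≡ e x y)

≈-trans : ∀ {n} {G H K : Graph n} → G ≈ H → H ≈ K → G ≈ K
≈-trans e f = pointwise λ x y → trans (adj≡ e x y) (adj≡ f x y)

_≈?_ : ∀ {n} (G H : Graph n) → Dec (G ≈ H)
G ≈? H = map′ pointwise adj≡ (all? λ x → all? λ y → adj G x y Bool.≟ adj H x y)

does-≟-sym : ∀ {n} (x y : Fin n) → does (x ≟ y) ≡ does (y ≟ x)
does-≟-sym x y = does-⇔ (mk⇔ sym sym) (x ≟ y) (y ≟ x)

abstract
  -- Arbitrary Boolean data are turned into a graph by symmetrising them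
  -- with ∧ and erasing the diagonal.
  decodeGraph : ∀ {n} → Fin (2 ^ (n * n)) → Graph n
  decodeGraph c .adj x y = not (does (x ≟ y)) ∧
    (decodeFunction c (combine x y) ∧ decodeFunction c (combine y x))
  decodeGraph c .adj-sym x y = cong₂ (λ b → not b ∧_) (does-≟-sym x y)
    (∧-comm (decodeFunction c (combine x y)) _)
  decodeGraph c .irrefl x rewrite dec-true (x ≟ x) refl = refl

  encodeGraph : ∀ {n} → Graph n → Fin (2 ^ (n * n))
  encodeGraph {n} G = encodeFunction (λ i → uncurry (adj G) (remQuot n i))

  decode-encodeGraph : ∀ {n} (G : Graph n) → decodeGraph (encodeGraph G) ≈ G
  decode-encodeGraph {n} G = pointwise entry
    where
    decoded : ∀ x y → decodeFunction (encodeGraph G) (combine x y) ≡ adj G x y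
    decoded x y = trans (decode-encodeFunction (λ i → uncurry (adj G) (remQuot n i)) (combine x y))
                        (cong (uncurry (adj G)) (remQuot-combine x y))

    entry : ∀ x y → adj (decodeGraph (encodeGraph G)) x y ≡ adj G x y
    entry x y rewrite decoded x y | decoded y x | adj-sym G y x | ∧-idem (adj G x y)
      with x ≟ y
    ... | yes refl = sym (irrefl G x)
    ... | no _     = refl

anyGraph? : ∀ {n} {P : Graph n → Set} → (∀ {G H} → G ≈ H → P G → P H) →
            (∀ G → Dec (P G)) → Dec (∃ P)
anyGraph? resp P? = map′
  (λ (c , p) → decodeGraph c , p)
  (λ (G , p) → encodeGraph G , resp (≈-sym (decode-encodeGraph G)) p)
  (any? λ c → P? (decodeGraph c))

-- Reachability in a finite relation (Warshall's algorithm)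

module _ {n : ℕ} {R : Fin n → Fin n → Set} where

  -- Walks whose interior vertices lie in the list, the head of the list being visited at most once.
  -- Recursion on the list makes this decidable.
  Via : List (Fin n) → Fin n → Fin n → Set
  Via []       x y = x ≡ y ⊎ R x y
  Via (v ∷ vs) x y = Via vs x y ⊎ (Via vs x v × Via vs v y)

  Via⇒Star : ∀ vs {x y} → Via vs x y → Star R x y
  Via⇒Star []       (inj₁ refl)    = ε
  Via⇒Star []       (inj₂ r)       = r ◅ ε
  Via⇒Star (v ∷ vs) (inj₁ p)       = Via⇒Star vs p
  Via⇒Star (v ∷ vs) (inj₂ (p , q)) = Via⇒Star vs p ◅◅ Via⇒Star vs q

  R⇒Via : ∀ vs {x y} → x ≡ y ⊎ R x y → Via vs x y
  R⇒Via []       r = r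
  R⇒Via (v ∷ vs) r = inj₁ (R⇒Via vs r)

  -- If the glued walk passes the head of the list several times, the part between the first and the
  -- last visit is cut out.
  Via-trans : ∀ {vs x v y} → v ∈ˡ vs → Via vs x v → Via vs v y → Via vs x y
  Via-trans (here refl) (inj₁ p)       (inj₁ q)       = inj₂ (p , q)
  Via-trans (here refl) (inj₁ p)       (inj₂ (_ , q)) = inj₂ (p , q)
  Via-trans (here refl) (inj₂ (p , _)) (inj₁ q)       = inj₂ (p , q)
  Via-trans (here refl) (inj₂ (p , _)) (inj₂ (_ , q)) = inj₂ (p , q)
  Via-trans (there i)   (inj₁ p)       (inj₁ q)       = inj₁ (Via-trans i p q)
  Via-trans (there i)   (inj₁ p)       (inj₂ (q , r)) = inj₂ (Via-trans i p q , r)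
  Via-trans (there i)   (inj₂ (p , q)) (inj₁ r)       = inj₂ (p , Via-trans i q r)
  Via-trans (there i)   (inj₂ (p , _)) (inj₂ (_ , r)) = inj₂ (p , r)

  Star⇒Via : ∀ {x y} → Star R x y → Via (allFin n) x y
  Star⇒Via ε        = R⇒Via (allFin n) (inj₁ refl)
  Star⇒Via (r ◅ rs) = Via-trans (∈-allFin _) (R⇒Via (allFin n) (inj₂ r)) (Star⇒Via rs)

  star? : (∀ x y → Dec (R x y)) → ∀ x y → Dec (Star R x y)
  star? R? x y = map′ (Via⇒Star (allFin n)) Star⇒Via (via? (allFin n) x y)
    where
    via? : ∀ vs x y → Dec (Via vs x y)
    via? []       x y = (x ≟ y) ⊎-dec R? x y
    via? (v ∷ vs) x y = via? vs x y ⊎-dec (via? vs x v ×-dec via? vs v y)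

-- Components

connected? : ∀ {n} (G : Graph n) x y → Dec (Connected G x y)
connected? G = star? λ x y → adj G x y Bool.≟ true

Connected-⊆ : ∀ {n} {G H : Graph n} → (∀ {x y} → adj G x y ≡ true → Connected H x y) →
              ∀ {x y} → Connected G x y → Connected H x y
Connected-⊆ edge ε        = ε
Connected-⊆ {G = G} {H} edge (e ◅ es) = edge e ◅◅ Connected-⊆ {G = G} {H} edge es

Connected-resp : ∀ {n} {G H : Graph n} → G ≈ H → ∀ {x y} → Connected G x y → Connected H x y
Connected-resp {G = G} {H} e = Connected-⊆ {G = G} {H} λ {x} {y} a → trans (sym (adj≡ e x y)) a ◅ ε

⇔? : ∀ {A B : Set} → Dec A → Dec B → Dec (A ⇔ B)
⇔? a? b? = map′ (uncurry mk⇔) (λ e → Equivalence.to e , Equivalence.from e)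
                ((a? →-dec b?) ×-dec (b? →-dec a?))

ComponentSize : ∀ {n} → Graph n → ℕ → Set
ComponentSize G s = ∃[ C ] (IsComponent G C × ∣ C ∣ ≡ s)

componentSize? : ∀ {n} (G : Graph n) s → Dec (ComponentSize G s)
componentSize? G s = anySubset? λ C →
  (any? λ v → all? λ u → ⇔? (u ∈? C) (connected? G v u)) ×-dec (∣ C ∣ ℕ.≟ s)

componentSize≤n : ∀ {n} (G : Graph n) s → ComponentSize G s → s ≤ n
componentSize≤n G _ (C , _ , refl) = ∣p∣≤n C

ComponentSize-resp : ∀ {n} {G H : Graph n} → G ≈ H → ∀ s → ComponentSize G s → ComponentSize H s
ComponentSize-resp {G = G} {H} e s (C , (v , comp) , ∣C∣≡s) =
  C , (v , λ u → mk⇔ (Connected-resp {G = G} {H} e ∘ Equivalence.to (comp u))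
                     (Equivalence.from (comp u) ∘ Connected-resp {G = H} {G} (≈-sym e)))
    , ∣C∣≡s

maxComponentSize : ∀ {n} (G : Graph n) → ∃ (IsMaxComponentSize G)
maxComponentSize {n} G = maximum (componentSize? G) n (componentSize≤n G)

isMaxComponentSize? : ∀ {n} (G : Graph n) s → Dec (IsMaxComponentSize G s)
isMaxComponentSize? {n} G = IsMaximum? (componentSize? G) n (componentSize≤n G)

IsMaxComponentSize-resp : ∀ {n} {G H : Graph n} → G ≈ H → ∀ {s} →
                          IsMaxComponentSize G s → IsMaxComponentSize H s
IsMaxComponentSize-resp e = IsMaximum-cong (ComponentSize-resp e)
  (ComponentSize-resp (≈-sym e))

subset : ∀ {n} {P : Fin n → Set} → (∀ x → Dec (P x)) → Subset n
subset P? = tabulate λ x → does (P? x)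

∈-subset : ∀ {n} {P : Fin n → Set} (P? : ∀ x → Dec (P x)) x → x ∈ subset P? ⇔ P x
∈-subset P? x = mk⇔
  (λ x∈ → witness (trans (sym (lookup∘tabulate _ x)) ([]=⇒lookup x∈)))
  (λ p → lookup⇒[]= x _ (trans (lookup∘tabulate _ x) (dec-true (P? x) p)))
  where
  witness : does (P? x) ≡ true → _
  witness e with P? x
  ... | yes p = p

-- When the ends of every edge of `G` are connected in `H`, the component of `v` in `G` lies inside
-- the component of `v` in `H`.
maxComponentSize-mono :
  ∀ {n} {G H : Graph n} → (∀ {x y} → adj G x y ≡ true → Connected H x y) →
  ∀ {s t} → IsMaxComponentSize G s → IsMaxComponentSize H t → s ≤ t
maxComponentSize-mono {G = G} {H} edge {t = t} maxG maxH = IsMaximum-≤ maxG bound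
  where
  bound : ∀ j → ComponentSize G j → j ≤ t
  bound _ (C , (v , comp) , refl) = ≤-trans
    (p⊆q⇒∣p∣≤∣q∣ λ {u} u∈C → Equivalence.from (∈-subset (connected? H v) u)
                               (Connected-⊆ {G = G} {H} edge (Equivalence.to (comp u) u∈C)))
    (proj₂ maxH _ (subset (connected? H v) , (v , ∈-subset (connected? H v)) , refl))

-- Linear algebra over GF(2)

false≢true : false ≢ true
false≢true ()

sum-false : ∀ {n} {f : Fin n → Bool} → (∀ x → f x ≡ false) → sum f ≡ false
sum-false {n} e = trans (sum-cong-≗ e) (sum-replicate-zero n)

sum-single : ∀ {n} {f : Fin n → Bool} a → (∀ x → x ≢ a → f x ≡ false) → sum f ≡ f a
sum-single {suc n} {f} a e = trans (sum-remove {i = a} f)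
  (trans (cong (f a xor_) (sum-false λ x → e _ (punchInᵢ≢i a x))) (xor-identityʳ (f a)))

δ : ∀ {n} → Fin n → Fin n → Bool
δ a x = does (x ≟ a)

δ-refl : ∀ {n} (a : Fin n) → δ a a ≡ true
δ-refl a = dec-true (a ≟ a) refl

δ-≢ : ∀ {n} {a x : Fin n} → x ≢ a → δ a x ≡ false
δ-≢ {a = a} {x} = dec-false (x ≟ a)

sum-δ : ∀ {n} (f : Fin n → Bool) a → sum (λ x → f x ∧ δ a x) ≡ f a
sum-δ f a = trans
  (sum-single a λ x x≢a → trans (cong (f x ∧_) (δ-≢ x≢a)) (∧-zeroʳ (f x)))
  (trans (cong (f a ∧_) (δ-refl a)) (∧-identityʳ (f a)))

∉⇒lookup : ∀ {n} {S : Subset n} {x} → x ∉ S → lookup S x ≡ false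
∉⇒lookup {S = S} {x} x∉S = ¬-not λ e → x∉S (lookup⇒[]= x S e)

lookup⇒∉ : ∀ {n} {S : Subset n} {x} → lookup S x ≡ false → x ∉ S
lookup⇒∉ e x∈S = false≢true (trans (sym e) ([]=⇒lookup x∈S))

∣[]≔∣ : ∀ {n} (S : Subset n) x → ∣ S [ x ]≔ inside ∣ ≡ suc ∣ S [ x ]≔ outside ∣
∣[]≔∣ (s     ∷ S) zero    = refl
∣[]≔∣ (true  ∷ S) (suc x) = cong suc (∣[]≔∣ S x)
∣[]≔∣ (false ∷ S) (suc x) = ∣[]≔∣ S x

∣insert∣ : ∀ {n} (S : Subset n) x → lookup S x ≡ false → ∣ S [ x ]≔ inside ∣ ≡ suc ∣ S ∣
∣insert∣ S x e = trans (∣[]≔∣ S x)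
  (cong (suc ∘ ∣_∣) (trans (cong (S [ x ]≔_) (sym e)) ([]≔-lookup S x)))

∣remove∣ : ∀ {n} (S : Subset n) x → lookup S x ≡ true → ∣ S ∣ ≡ suc ∣ S [ x ]≔ outside ∣
∣remove∣ S x e = trans
  (cong ∣_∣ (trans (sym ([]≔-lookup S x)) (cong (S [ x ]≔_) e))) (∣[]≔∣ S x)

Dependency : ∀ {m n} → Matrix m n → Subset n → Set
Dependency {n = n} M S = ∃ λ (c : Fin n → Bool) →
  (∀ j → lookup S j ≡ false → c j ≡ false) ×
  (∀ i → sum (λ j → c j ∧ M i j) ≡ false) × ∃[ j ] c j ≡ true

-- Gaussian elimination, one row at a time.
dependency : ∀ {r n} (M : Matrix r n) (S : Subset n) → r < ∣ S ∣ → Dependency M S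
dependency {zero} {n} M S 0<∣S∣ with nonempty? S
... | no empty = contradiction
      (subst (0 <_) (trans (cong ∣_∣ (Empty-unique empty)) (∣⊥∣≡0 n)) 0<∣S∣) λ ()
... | yes (x , x∈S) = δ x , (λ j e → δ-≢ {a = x} {j} λ { refl → lookup⇒∉ e x∈S }) , (λ ()) , x , δ-refl x
dependency {suc r} M S r<∣S∣ with any? (λ j → (lookup S j Bool.≟ true) ×-dec (M zero j Bool.≟ true))
... | no none = c , supp , (λ { zero → sum-false vanish ; (suc i) → ker i }) , nonzero
  where
  rec : Dependency (M ∘ suc) S
  rec = dependency (M ∘ suc) S (<⇒≤ r<∣S∣)
  c = proj₁ rec
  supp = proj₁ (proj₂ rec)
  ker = proj₁ (proj₂ (proj₂ rec))
  nonzero = proj₂ (proj₂ (proj₂ rec))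

  vanish : ∀ j → c j ∧ M zero j ≡ false
  vanish j with lookup S j in Sj | M zero j in Mj
  ... | false | _     rewrite supp j Sj = refl
  ... | true  | false = ∧-zeroʳ (c j)
  ... | true  | true  = contradiction (j , Sj , Mj) none
... | yes (p , Sp , Mp) = c′ , supp′ , ker′ , j₀ , nonzero
  where
  S′ = S [ p ]≔ outside

  -- Row zero is added to the rows with a 1 in the pivot column `p`, which clears that column below
  -- row zero.
  M′ : Matrix _ _
  M′ = λ i j → M (suc i) j xor (M (suc i) p ∧ M zero j)

  rec : Dependency M′ S′
  rec = dependency M′ S′ (≤-pred (subst (suc r <_) (∣remove∣ S p Sp) r<∣S∣))
  c = proj₁ rec
  supp = proj₁ (proj₂ rec)
  ker = proj₁ (proj₂ (proj₂ rec))
  j₀ = proj₁ (proj₂ (proj₂ (proj₂ rec)))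
  cj₀ = proj₂ (proj₂ (proj₂ (proj₂ rec)))

  cp : c p ≡ false
  cp = supp p (lookup∘update p S outside)

  -- The value of row zero on `c`. Taken as the coefficient of the pivot column, it makes row zero
  -- vanish as well.
  t = sum λ j → c j ∧ M zero j

  c′ : Fin _ → Bool
  c′ = λ j → c j xor (t ∧ δ p j)

  supp′ : ∀ j → lookup S j ≡ false → c′ j ≡ false
  supp′ j Sj = trans
    (cong₂ (λ a b → a xor (t ∧ b)) (supp j (trans (lookup∘update′ j≢p S outside) Sj)) (δ-≢ j≢p))
    (∧-zeroʳ t)
    where
    j≢p : j ≢ p
    j≢p refl = false≢true (trans (sym Sj) Sp)

  sum-c′ : ∀ w → sum (λ j → c′ j ∧ w j) ≡ sum (λ j → c j ∧ w j) xor (t ∧ w p)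
  sum-c′ w = begin
    sum (λ j → c′ j ∧ w j)
      ≡⟨ sum-cong-≗ (λ j → solve 4 (λ a b d e → (a :+ b :* d) :* e := a :* e :+ b :* (e :* d))
                         refl (c j) t (δ p j) (w j)) ⟩
    sum (λ j → (c j ∧ w j) xor (t ∧ (w j ∧ δ p j)))
      ≡⟨ ∑-distrib-+ (λ j → c j ∧ w j) _ ⟩
    sum (λ j → c j ∧ w j) xor sum (λ j → t ∧ (w j ∧ δ p j))
      ≡⟨ cong (sum (λ j → c j ∧ w j) xor_)
           (trans (sym (*-distribˡ-sum t (λ j → w j ∧ δ p j))) (cong (t ∧_) (sum-δ w p))) ⟩
    sum (λ j → c j ∧ w j) xor (t ∧ w p) ∎
    where open ≡-Reasoning
          open xor-∧-Solver

  ker′ : ∀ i → sum (λ j → c′ j ∧ M i j) ≡ false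
  ker′ zero = trans (sum-c′ (M zero))
    (trans (cong (λ b → t xor (t ∧ b)) Mp) (trans (cong (t xor_) (∧-identityʳ t)) (xor-same t)))
  ker′ (suc i) = begin
    sum (λ j → c′ j ∧ M (suc i) j)
      ≡⟨ sum-c′ (M (suc i)) ⟩
    sum (λ j → c j ∧ M (suc i) j) xor (t ∧ M (suc i) p)
      ≡⟨ cong (sum (λ j → c j ∧ M (suc i) j) xor_)
           (trans (∧-comm t _) (*-distribˡ-sum (M (suc i) p) (λ j → c j ∧ M zero j))) ⟩
    sum (λ j → c j ∧ M (suc i) j) xor sum (λ j → M (suc i) p ∧ (c j ∧ M zero j))
      ≡⟨ ∑-distrib-+ (λ j → c j ∧ M (suc i) j) _ ⟨
    sum (λ j → (c j ∧ M (suc i) j) xor (M (suc i) p ∧ (c j ∧ M zero j)))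
      ≡⟨ sum-cong-≗ (λ j → solve 4 (λ a b d e → a :* b :+ d :* (a :* e) := a :* (b :+ d :* e))
                         refl (c j) (M (suc i) j) (M (suc i) p) (M zero j)) ⟩
    sum (λ j → c j ∧ M′ i j)
      ≡⟨ ker i ⟩
    false ∎
    where open ≡-Reasoning
          open xor-∧-Solver

  j₀≢p : j₀ ≢ p
  j₀≢p j₀≡p = false≢true (trans (sym cp) (trans (cong c (sym j₀≡p)) cj₀))

  nonzero : c′ j₀ ≡ true
  nonzero rewrite cj₀ | δ-≢ {a = p} {j₀} j₀≢p | ∧-zeroʳ t = refl

independent⇒≤rows : ∀ {r n} (M : Matrix r n) {S} → IndependentColumns M S → ∣ S ∣ ≤ r
independent⇒≤rows M {S} ind = ≮⇒≥ λ r<∣S∣ →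
  let c , supp , ker , j , cj = dependency M S r<∣S∣
  in false≢true (trans (sym (ind c (λ j j∉S → supp j (∉⇒lookup j∉S)) ker j)) cj)

independentColumns? : ∀ {m n} (M : Matrix m n) S → Dec (IndependentColumns M S)
independentColumns? M S = allFunction?
  (λ f≗g p supp ker j → trans (sym (f≗g j)) (p
     (λ j j∉S → trans (f≗g j) (supp j j∉S))
     (λ i → trans (sum-cong-≗ λ j → cong (_∧ M i j) (f≗g j)) (ker i)) j))
  λ c → (all? λ j → ¬? (j ∈? S) →-dec (c j Bool.≟ false)) →-dec
        ((all? λ i → sum (λ j → c j ∧ M i j) Bool.≟ false) →-dec
         (all? λ j → c j Bool.≟ false))

-- Rank and minimum rank

IndependentSize : ∀ {m n} → Matrix m n → ℕ → Set
IndependentSize M r = ∃[ S ] (IndependentColumns M S × ∣ S ∣ ≡ r)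

independentSize? : ∀ {m n} (M : Matrix m n) r → Dec (IndependentSize M r)
independentSize? M r = anySubset? λ S → independentColumns? M S ×-dec (∣ S ∣ ℕ.≟ r)

independentSize≤n : ∀ {m n} (M : Matrix m n) r → IndependentSize M r → r ≤ n
independentSize≤n M _ (S , _ , refl) = ∣p∣≤n S

IndependentSize-resp : ∀ {m n} {M N : Matrix m n} → (∀ x y → M x y ≡ N x y) →
                       ∀ r → IndependentSize M r → IndependentSize N r
IndependentSize-resp e r (S , ind , ∣S∣≡r) = S ,
  (λ c supp ker → ind c supp λ i → trans (sum-cong-≗ λ j → cong (c j ∧_) (e i j)) (ker i)) , ∣S∣≡r

rank : ∀ {m n} (M : Matrix m n) → ∃ (IsRank M)
rank {n = n} M = maximum (independentSize? M) n (independentSize≤n M)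

isRank? : ∀ {m n} (M : Matrix m n) r → Dec (IsRank M r)
isRank? {n = n} M = IsMaximum? (independentSize? M) n (independentSize≤n M)

IsRank-resp : ∀ {m n} {M N : Matrix m n} → (∀ x y → M x y ≡ N x y) →
              ∀ {r} → IsRank M r → IsRank N r
IsRank-resp e = IsMaximum-cong (IndependentSize-resp e)
  (IndependentSize-resp λ x y → sym (e x y))

FillingRank : ∀ {n} → Graph n → ℕ → Set
FillingRank G r = ∃[ d ] IsRank (fillDiagonal G d) r

fillingRank? : ∀ {n} (G : Graph n) r → Dec (FillingRank G r)
fillingRank? G r = anyFunction?
  (λ f≗g → IsRank-resp (fill f≗g)) (λ d → isRank? (fillDiagonal G d) r)
  where
  fill : ∀ {f g} → f ≗ g → ∀ x y → fillDiagonal G f x y ≡ fillDiagonal G g x y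
  fill f≗g x y with x ≟ y
  ... | yes _ = f≗g x
  ... | no _  = refl

FillingRank-resp : ∀ {n} {G H : Graph n} → G ≈ H → ∀ r → FillingRank G r → FillingRank H r
FillingRank-resp {G = G} {H} e r (d , rk) = d , IsRank-resp fill rk
  where
  fill : ∀ x y → fillDiagonal G d x y ≡ fillDiagonal H d x y
  fill x y with x ≟ y
  ... | yes _ = refl
  ... | no _  = adj≡ e x y

MinimumRank≤ : ∀ {n} → ℕ → Graph n → Set
MinimumRank≤ k G = ∃[ r ] (IsMinimumRank G r × r ≤ k)

minimumRank≤? : ∀ {n} k (G : Graph n) → Dec (MinimumRank≤ k G)
minimumRank≤? k G = minimum≤? (fillingRank? G) k

MinimumRank≤-resp : ∀ {n k} {G H : Graph n} → G ≈ H → MinimumRank≤ k G → MinimumRank≤ k H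
MinimumRank≤-resp e (r , min , r≤k) = r ,
  IsMinimum-cong (FillingRank-resp e) (FillingRank-resp (≈-sym e)) min , r≤k

-- The matrix `WᵀW`, that is, the sum of the squares `wwᵀ` over the rows `w` of `W`.
gram : ∀ {r n} → Matrix r n → Matrix n n
gram W x y = sum λ i → W i x ∧ W i y

-- The kernel of `W` is contained in that of `WᵀW`, so columns independent in `WᵀW` are independent
-- in `W`, which has `r` rows.
gram-independent : ∀ {r n} (W : Matrix r n) {S} → IndependentColumns (gram W) S → ∣ S ∣ ≤ r
gram-independent W {S} ind = independent⇒≤rows W λ c supp ker → ind c supp λ x → begin
  sum (λ y → c y ∧ gram W x y)
    ≡⟨ sum-cong-≗ (λ y → *-distribˡ-sum (c y) (λ i → W i x ∧ W i y)) ⟩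
  sum (λ y → sum (λ i → c y ∧ (W i x ∧ W i y)))
    ≡⟨ ∑-comm (λ y i → c y ∧ (W i x ∧ W i y)) ⟩
  sum (λ i → sum (λ y → c y ∧ (W i x ∧ W i y)))
    ≡⟨ sum-cong-≗ (λ i → sum-cong-≗ λ y → solve 3 (λ a b d → a :* (b :* d) := b :* (a :* d))
                       refl (c y) (W i x) (W i y)) ⟩
  sum (λ i → sum (λ y → W i x ∧ (c y ∧ W i y)))
    ≡⟨ sum-false (λ i → trans (sym (*-distribˡ-sum (W i x) (λ y → c y ∧ W i y)))
                        (trans (cong (W i x ∧_) (ker i)) (∧-zeroʳ (W i x)))) ⟩
  false ∎
  where open ≡-Reasoning
        open xor-∧-Solver

-- The diagonal of the Gram matrix serves as the filling; the filled matrix is then `WᵀW` itself.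
gram⇒MinimumRank≤ : ∀ {r n k} (G : Graph n) (W : Matrix r n) →
  (∀ {x y} → x ≢ y → adj G x y ≡ gram W x y) → r ≤ k → MinimumRank≤ k G
gram⇒MinimumRank≤ {r} G W e r≤k =
  let r₁ , rk₁ = rank (fillDiagonal G d)
      r₁≤r = IsMaximum-≤ rk₁ λ { j size →
        let S , ind , ∣S∣≡j = IndependentSize-resp fill j size
        in subst (_≤ r) ∣S∣≡j (gram-independent W ind) }
      m , min , m≤r₁ = minimum (fillingRank? G) {r₁} (d , rk₁)
  in m , min , ≤-trans m≤r₁ (≤-trans r₁≤r r≤k)
  where
  d = λ x → gram W x x

  fill : ∀ x y → fillDiagonal G d x y ≡ gram W x y
  fill x y with x ≟ y
  ... | yes refl = refl
  ... | no x≢y   = e x≢y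

-- Vertex-minors

localComplement-cong : ∀ {n} {G H : Graph n} v → G ≈ H → localComplement G v ≈ localComplement H v
localComplement-cong v e = pointwise λ x y →
  cong₂ (λ a b → a xor (not (does (x ≟ y)) ∧ b)) (adj≡ e x y) (cong₂ _∧_ (adj≡ e v x) (adj≡ e v y))

Step : ∀ {n} → Graph n → Graph n → Set
Step G H = ∃[ v ] localComplement G v ≈ H

induced : ∀ {m n} → Graph n → (Fin m → Fin n) → Graph m
induced G ι .adj x y     = adj G (ι x) (ι y)
induced G ι .adj-sym x y = adj-sym G (ι x) (ι y)
induced G ι .irrefl x    = irrefl G (ι x)

induced-cong : ∀ {m n} {G H : Graph n} (ι : Fin m → Fin n) → G ≈ H → induced G ι ≈ induced H ι
induced-cong ι e = pointwise λ x y → adj≡ e (ι x) (ι y)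

localComplement-deleteVertex : ∀ {n} (G : Graph (suc n)) a v →
  localComplement (deleteVertex G a) v ≈ deleteVertex (localComplement G (punchIn a v)) a
localComplement-deleteVertex G a v = pointwise λ x y →
  cong (λ b → adj G (punchIn a x) (punchIn a y) xor
              (not b ∧ (adj G (punchIn a v) (punchIn a x) ∧ adj G (punchIn a v) (punchIn a y))))
    (does-⇔ (mk⇔ (cong (punchIn a)) (punchIn-injective a x y)) (x ≟ y) (punchIn a x ≟ punchIn a y))

VertexMinor-resp : ∀ {m n} {H : Graph m} {ι} {G G′ : Graph n} → G ≈ G′ →
                   VertexMinor H ι G → VertexMinor H ι G′
VertexMinor-resp e (same ι≗id G≡H)  = same ι≗id λ x y → trans (sym (adj≡ e x y)) (G≡H x y)
VertexMinor-resp e (local v vm)     = local v (VertexMinor-resp (localComplement-cong v e) vm)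
VertexMinor-resp e (delete v ι′ ι≗ vm) =
  delete v ι′ ι≗ (VertexMinor-resp (induced-cong (punchIn v) e) vm)

VertexMinor-cong : ∀ {m n} {H : Graph m} {ι ι′ : Fin m → Fin n} {G} → ι ≗ ι′ →
                   VertexMinor H ι G → VertexMinor H ι′ G
VertexMinor-cong e (same ι≗id G≡H)     = same (λ x → trans (sym (e x)) (ι≗id x)) G≡H
VertexMinor-cong e (local v vm)        = local v (VertexMinor-cong e vm)
VertexMinor-cong e (delete v ι₁ ι≗ vm) = delete v ι₁ (λ x → trans (sym (e x)) (ι≗ x)) vm

-- Local complementations commute with deletions, so all deletions can be
-- postponed to the end.
VertexMinor⇒induced : ∀ {m n} {H : Graph m} {ι} {G : Graph n} → VertexMinor H ι G →
                      ∃[ K ] (Star Step G K × induced K ι ≈ H)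
VertexMinor⇒induced {G = G} (same ι≗id G≡H) =
  G , ε , pointwise λ x y → trans (cong₂ (adj G) (ι≗id x) (ι≗id y)) (G≡H x y)
VertexMinor⇒induced (local v vm) =
  let K , steps , e = VertexMinor⇒induced vm
  in K , (v , ≈-refl) ◅ steps , e
VertexMinor⇒induced {n = suc n} {ι = ι} (delete a ι′ ι≗ vm) =
  let K , steps , e = VertexMinor⇒induced vm
      K′ , steps′ , e′ = lift steps ≈-refl
  in K′ , steps′ , ≈-trans
       (pointwise λ x y → trans (cong₂ (adj K′) (ι≗ x) (ι≗ y)) (sym (adj≡ e′ (ι′ x) (ι′ y)))) e
  where
  lift : ∀ {L K} {G : Graph (suc n)} → Star Step L K → L ≈ deleteVertex G a →
         ∃[ K′ ] (Star Step G K′ × K ≈ deleteVertex K′ a)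
  lift ε e = _ , ε , e
  lift {G = G} ((v , f) ◅ fs) e =
    let K′ , steps , e′ = lift {G = localComplement G (punchIn a v)} fs
          (≈-trans (≈-sym f) (≈-trans (localComplement-cong v e) (localComplement-deleteVertex G a v)))
    in K′ , (punchIn a v , ≈-refl) ◅ steps , e′

-- The same numbering of vertices as `_↑ˡ k`, but in `Fin (k + n)`, where `suc k + n` computes: the
-- last ancilla is always `fromℕ (k + n)` and can be split off by recursion on `k`.
embed : ∀ k {n} → Fin n → Fin (k + n)
embed zero    x     = x
embed (suc k) {n} x = punchIn (fromℕ (k + n)) (embed k x)

toℕ-punchIn-fromℕ : ∀ {n} (x : Fin n) → toℕ (punchIn (fromℕ n) x) ≡ toℕ x
toℕ-punchIn-fromℕ zero    = refl
toℕ-punchIn-fromℕ (suc x) = cong suc (toℕ-punchIn-fromℕ x)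

toℕ-embed : ∀ k {n} (x : Fin n) → toℕ (embed k x) ≡ toℕ x
toℕ-embed zero    x = refl
toℕ-embed (suc k) x = trans (toℕ-punchIn-fromℕ (embed k x)) (toℕ-embed k x)

induced⇒VertexMinor : ∀ k {n} {H : Graph n} {G : Graph (k + n)} →
                      induced G (embed k) ≈ H → VertexMinor H (embed k) G
induced⇒VertexMinor zero    e = same (λ _ → refl) (adj≡ e)
induced⇒VertexMinor (suc k) e =
  delete (fromℕ _) (embed k) (λ _ → refl) (induced⇒VertexMinor k (pointwise (adj≡ e)))

-- Local complementation transported to the finite set of codes, where reachability is decidable by
-- `star?`.
StepCode : ∀ n → Fin (2 ^ (n * n)) → Fin (2 ^ (n * n)) → Set
StepCode n c c′ = Step {n} (decodeGraph c) (decodeGraph c′)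

encode-steps : ∀ {n} {G K : Graph n} {c} → Star Step G K → decodeGraph c ≈ G →
               ∃[ c′ ] (Star (StepCode n) c c′ × decodeGraph c′ ≈ K)
encode-steps {c = c} ε e = c , ε , e
encode-steps (_◅_ {j = G′} (v , f) fs) e =
  let c′ , steps , e′ = encode-steps {c = encodeGraph G′} fs (decode-encodeGraph G′)
  in c′ , (v , ≈-trans (localComplement-cong v e) (≈-trans f (≈-sym (decode-encodeGraph G′)))) ◅ steps , e′

-- With all deletions postponed, the question is whether local complementations reach a graph that
-- induces `H` on the original vertices.
vertexMinor? : ∀ k {n} (H : Graph n) (G : Graph (k + n)) → Dec (VertexMinor H (embed k) G)
vertexMinor? k H G = map′ sound complete
  (any? λ c →
    star? {R = StepCode (k + _)} (λ c c′ → any? λ v → localComplement (decodeGraph c) v ≈? decodeGraph c′) (encodeGraph G) c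
    ×-dec (induced (decodeGraph c) (embed k) ≈? H))
  where
  replay : ∀ {c c′} → Star (StepCode (k + _)) c c′ → induced (decodeGraph c′) (embed k) ≈ H →
           VertexMinor H (embed k) (decodeGraph c)
  replay ε              e = induced⇒VertexMinor k e
  replay ((v , f) ◅ fs) e = local v (VertexMinor-resp (≈-sym f) (replay fs e))

  sound : ∃[ c ] (Star (StepCode (k + _)) (encodeGraph G) c × induced (decodeGraph c) (embed k) ≈ H) →
          VertexMinor H (embed k) G
  sound (c , steps , e) = VertexMinor-resp (decode-encodeGraph G) (replay steps e)

  complete : VertexMinor H (embed k) G →
             ∃[ c ] (Star (StepCode (k + _)) (encodeGraph G) c × induced (decodeGraph c) (embed k) ≈ H)
  complete vm =
    let K , steps , e = VertexMinor⇒induced vm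
        c , steps′ , e′ = encode-steps steps (decode-encodeGraph G)
    in c , steps′ , ≈-trans (induced-cong (embed k) e′) e

VertexMinor-respˡ : ∀ {m n} {H H′ : Graph m} {ι} {G : Graph n} → H ≈ H′ →
                    VertexMinor H ι G → VertexMinor H′ ι G
VertexMinor-respˡ e (same ι≗id G≡H)     = same ι≗id λ x y → trans (G≡H x y) (adj≡ e x y)
VertexMinor-respˡ e (local v vm)        = local v (VertexMinor-respˡ e vm)
VertexMinor-respˡ e (delete v ι₁ ι≗ vm) = delete v ι₁ ι≗ (VertexMinor-respˡ e vm)

-- Common ancestors and the ancilla distance

CommonAncestor : ∀ {m n} → (Fin m → Fin n) → Graph m → Graph m → Set
CommonAncestor {n = n} ι G G′ = ∃ λ (Ĝ : Graph n) → VertexMinor G ι Ĝ × VertexMinor G′ ι Ĝ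

-- The codomains of `ι` and `ι′` are only propositionally equal, so the labellings are compared
-- through `toℕ`.
CommonAncestor-cast : ∀ {m n n′} {ι : Fin m → Fin n} {ι′ : Fin m → Fin n′} {G G′} → n ≡ n′ →
  (∀ x → toℕ (ι x) ≡ toℕ (ι′ x)) → CommonAncestor ι G G′ → CommonAncestor ι′ G G′
CommonAncestor-cast refl e (Ĝ , vm , vm′) =
  Ĝ , VertexMinor-cong (toℕ-injective ∘ e) vm , VertexMinor-cong (toℕ-injective ∘ e) vm′

module _ (k : ℕ) {n} {G G′ : Graph n} where

  ↑ˡ⇒embed : CommonAncestor (_↑ˡ k) G G′ → CommonAncestor (embed k) G G′
  ↑ˡ⇒embed = CommonAncestor-cast (+-comm n k) λ x → trans (toℕ-↑ˡ x k) (sym (toℕ-embed k x))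

  embed⇒↑ˡ : CommonAncestor (embed k) G G′ → CommonAncestor (_↑ˡ k) G G′
  embed⇒↑ˡ = CommonAncestor-cast (+-comm k n) λ x → trans (toℕ-embed k x) (sym (toℕ-↑ˡ x k))

commonAncestor? : ∀ {n} (G G′ : Graph n) k → Dec (CommonAncestor (_↑ˡ k) G G′)
commonAncestor? G G′ k = map′ (embed⇒↑ˡ k) (↑ˡ⇒embed k) (anyGraph?
  (λ e (vm , vm′) → VertexMinor-resp e vm , VertexMinor-resp e vm′)
  λ Ĝ → vertexMinor? k G Ĝ ×-dec vertexMinor? k G′ Ĝ)

AncillaDistance≤ : ∀ {n} → ℕ → Graph n → Graph n → Set
AncillaDistance≤ k G G′ = ∃[ d ] (IsAncillaDistance G G′ d × d ≤ k)

ancillaDistance≤? : ∀ {n} k (G G′ : Graph n) → Dec (AncillaDistance≤ k G G′)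
ancillaDistance≤? k G G′ = minimum≤? (commonAncestor? G G′) k

AncillaDistance≤-resp : ∀ {n k} {G G′ G″ : Graph n} → G′ ≈ G″ →
                        AncillaDistance≤ k G G′ → AncillaDistance≤ k G G″
AncillaDistance≤-resp e (d , min , d≤k) = d , IsMinimum-cong
  (λ _ (Ĝ , vm , vm′) → Ĝ , vm , VertexMinor-respˡ e vm′)
  (λ _ (Ĝ , vm , vm′) → Ĝ , vm , VertexMinor-respˡ (≈-sym e) vm′) min , d≤k

-- Adding rank-one matrices by means of ancillas

localComplement-≢ : ∀ {n} (G : Graph n) v {x y} → x ≢ y →
  adj (localComplement G v) x y ≡ adj G x y xor (adj G v x ∧ adj G v y)
localComplement-≢ G v {x} {y} x≢y rewrite dec-false (x ≟ y) x≢y = refl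

graph-ext : ∀ {n} {G H : Graph n} → (∀ {x y} → x ≢ y → adj G x y ≡ adj H x y) → G ≈ H
graph-ext {G = G} {H} e = pointwise entry
  where
  entry : ∀ x y → adj G x y ≡ adj H x y
  entry x y with x ≟ y
  ... | yes refl = trans (irrefl G x) (sym (irrefl H x))
  ... | no x≢y   = e x≢y

localComplement-row : ∀ {n} (G : Graph n) v x → adj (localComplement G v) v x ≡ adj G v x
localComplement-row G v x with v ≟ x
... | yes refl = xor-identityʳ _
... | no _ rewrite irrefl G v = xor-identityʳ _

localComplement-involutive : ∀ {n} (G : Graph n) v → localComplement (localComplement G v) v ≈ G
localComplement-involutive G v = graph-ext λ {x} {y} x≢y → begin
  adj (localComplement (localComplement G v) v) x y
    ≡⟨ localComplement-≢ (localComplement G v) v x≢y ⟩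
  adj (localComplement G v) x y xor (adj (localComplement G v) v x ∧ adj (localComplement G v) v y)
    ≡⟨ cong₂ _xor_ (localComplement-≢ G v x≢y) (cong₂ _∧_ (localComplement-row G v x) (localComplement-row G v y)) ⟩
  (adj G x y xor (adj G v x ∧ adj G v y)) xor (adj G v x ∧ adj G v y)
    ≡⟨ solve 2 (λ a b → (a :+ b) :+ b := a) refl (adj G x y) (adj G v x ∧ adj G v y) ⟩
  adj G x y ∎
  where open ≡-Reasoning
        open xor-∧-Solver

data PunchInView {n} (a : Fin (suc n)) : Fin (suc n) → Set where
  new : PunchInView a a
  old : ∀ x → PunchInView a (punchIn a x)

punchInView : ∀ {n} (a x : Fin (suc n)) → PunchInView a x
punchInView a x with a ≟ x
... | yes refl = new
... | no a≢x   = subst (PunchInView a) (punchIn-punchOut a≢x) (old (punchOut a≢x))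

module _ {n} (a : Fin (suc n)) (G : Graph n) (w : Fin n → Bool) where

  private
    rows : Fin n → Fin (suc n) → Bool
    rows x = insertAt (adj G x) a (w x)

    row-new : Fin (suc n) → Bool
    row-new = insertAt w a false

    M : Matrix (suc n) (suc n)
    M = insertAt rows a row-new

    M-new-new : M a a ≡ false
    M-new-new = trans (cong-app (insertAt-lookup rows a row-new) a) (insertAt-lookup w a false)

    M-new-old : ∀ y → M a (punchIn a y) ≡ w y
    M-new-old y = trans (cong-app (insertAt-lookup rows a row-new) (punchIn a y))
                        (insertAt-punchIn w a false y)

    M-old-new : ∀ x → M (punchIn a x) a ≡ w x
    M-old-new x = trans (cong-app (insertAt-punchIn rows a row-new x) a)
                        (insertAt-lookup (adj G x) a (w x))

    M-old-old : ∀ x y → M (punchIn a x) (punchIn a y) ≡ adj G x y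
    M-old-old x y = trans (cong-app (insertAt-punchIn rows a row-new x) (punchIn a y))
                          (insertAt-punchIn (adj G x) a (w x) y)

  addVertex : Graph (suc n)
  addVertex .adj = M
  addVertex .adj-sym x y with punchInView a x | punchInView a y
  ... | new    | new    = refl
  ... | new    | old y′ = trans (M-new-old y′) (sym (M-old-new y′))
  ... | old x′ | new    = trans (M-old-new x′) (sym (M-new-old x′))
  ... | old x′ | old y′ = trans (M-old-old x′ y′) (trans (adj-sym G x′ y′) (sym (M-old-old y′ x′)))
  addVertex .irrefl x with punchInView a x
  ... | new    = M-new-new
  ... | old x′ = trans (M-old-old x′ x′) (irrefl G x′)

  -- The complementation adds `wwᵀ` to `G` off the diagonal. A second complementation at `a`,
  -- followed by the deletion of `a`, restores `G`.
  addAncilla : Graph (suc n)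
  addAncilla = localComplement addVertex a

  addAncilla-row : ∀ x → adj addAncilla a (punchIn a x) ≡ w x
  addAncilla-row x = trans (localComplement-row addVertex a (punchIn a x)) (M-new-old x)

  addAncilla-≢ : ∀ {x y} → x ≢ y →
    adj addAncilla (punchIn a x) (punchIn a y) ≡ adj G x y xor (w x ∧ w y)
  addAncilla-≢ {x} {y} x≢y = trans
    (localComplement-≢ addVertex a (x≢y ∘ punchIn-injective a x y))
    (cong₂ _xor_ (M-old-old x y) (cong₂ _∧_ (M-new-old x) (M-new-old y)))

  addAncilla-VertexMinor : ∀ {m} {H : Graph m} {ι} →
    VertexMinor H ι G → VertexMinor H (punchIn a ∘ ι) addAncilla
  addAncilla-VertexMinor {ι = ι} vm = local a (delete a ι (λ _ → refl) (VertexMinor-resp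
    (≈-sym (≈-trans (induced-cong (punchIn a) (localComplement-involutive addVertex a))
                    (pointwise M-old-old))) vm))

-- Requiring that `G` arise by deletions alone keeps the adjacencies between the original vertices
-- explicit, so that squares can be added to them one after another.
Realizable : ∀ {n} → ℕ → Graph n → Graph n → Set
Realizable {n} k G G′ = ∃ λ (Ĝ : Graph (k + n)) →
  induced Ĝ (embed k) ≈ G × VertexMinor G′ (embed k) Ĝ

embed-injective : ∀ k {n} {x y : Fin n} → embed k x ≡ embed k y → x ≡ y
embed-injective k {x = x} {y} e =
  toℕ-injective (trans (sym (toℕ-embed k x)) (trans (cong toℕ e) (toℕ-embed k y)))

-- Extension by zero to the ancillas already present.
padding : ∀ k {n} → (Fin n → Bool) → Fin (k + n) → Bool
padding zero    w = w
padding (suc k) w = insertAt (padding k w) (fromℕ _) false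

padding-embed : ∀ k {n} (w : Fin n → Bool) x → padding k w (embed k x) ≡ w x
padding-embed zero    w x = refl
padding-embed (suc k) w x = trans
  (insertAt-punchIn (padding k w) (fromℕ _) false (embed k x)) (padding-embed k w x)

-- `addAncilla` adds `wwᵀ` to the induced graph `G₁`, and undoing it leads back to `Ĝ` and from
-- there to `G′`.
realize-square : ∀ {n k} {G G₁ G′ : Graph n} (w : Fin n → Bool) →
  (∀ {x y} → x ≢ y → adj G x y ≡ adj G₁ x y xor (w x ∧ w y)) →
  Realizable k G₁ G′ → Realizable (suc k) G G′
realize-square {k = k} w e (Ĝ , e₁ , vm) =
  addAncilla a Ĝ ŵ , graph-ext entry , addAncilla-VertexMinor a Ĝ ŵ vm
  where
  a = fromℕ _
  ŵ = padding k w

  entry : ∀ {x y} → x ≢ y → _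
  entry {x} {y} x≢y = trans (addAncilla-≢ a Ĝ ŵ (x≢y ∘ embed-injective k))
    (trans (cong₂ _xor_ (adj≡ e₁ x y) (cong₂ _∧_ (padding-embed k w x) (padding-embed k w y)))
           (sym (e x≢y)))

-- uvᵀ + vuᵀ = vvᵀ + (u+v)(u+v)ᵀ + uuᵀ.  The two adjacent ancillas are
-- eliminated by local complementations at the first, the second, and
-- the first one again.
realize-hyperbolic : ∀ {n k} {G G₁ G′ : Graph n} (u v : Fin n → Bool) →
  (∀ {x y} → x ≢ y → adj G x y ≡ adj G₁ x y xor ((u x ∧ v y) xor (v x ∧ u y))) →
  Realizable k G₁ G′ → Realizable (2 + k) G G′
realize-hyperbolic {k = k} {G} {G₁} u v e (Ĝ , e₁ , vm) =
  localComplement X₁ (punchIn b a) , graph-ext entry ,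
  local (punchIn b a) (VertexMinor-resp (≈-sym (localComplement-involutive X₁ (punchIn b a)))
    (addAncilla-VertexMinor b X₂ ŵ (addAncilla-VertexMinor a Ĝ v̂ vm)))
  where
  a = fromℕ (k + _)
  b = fromℕ (suc k + _)
  v̂ = padding k v
  X₂ = addAncilla a Ĝ v̂

  u+v : Fin _ → Bool
  u+v x = u x xor v x

  ŵ : Fin (suc k + _) → Bool
  -- The value `true` at `a` makes the two ancillas adjacent. Complementing at `b` therefore changes
  -- the row of `a` on the original vertices from `v` to `v + (u+v) = u`, so that the last
  -- complementation at `a` adds `uuᵀ`.
  ŵ = insertAt (padding k u+v) a true

  X₁ = addAncilla b X₂ ŵ

  ŵ-old : ∀ x → ŵ (punchIn a (embed k x)) ≡ u+v x
  ŵ-old x = trans (insertAt-punchIn (padding k u+v) a true (embed k x)) (padding-embed k u+v x)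

  open ≡-Reasoning
  open xor-∧-Solver

  row : ∀ x → adj X₁ (punchIn b a) (embed (2 + k) x) ≡ u x
  row x = begin
    adj X₁ (punchIn b a) (embed (2 + k) x)
      ≡⟨ addAncilla-≢ b X₂ ŵ (punchInᵢ≢i a (embed k x) ∘ sym) ⟩
    adj X₂ a (punchIn a (embed k x)) xor (ŵ a ∧ ŵ (punchIn a (embed k x)))
      ≡⟨ cong₂ _xor_ (trans (addAncilla-row a Ĝ v̂ (embed k x)) (padding-embed k v x))
                     (cong₂ _∧_ (insertAt-lookup (padding k u+v) a true) (ŵ-old x)) ⟩
    v x xor (true ∧ (u x xor v x))
      ≡⟨ solve 2 (λ p q → q :+ (con true :* (p :+ q)) := p) refl (u x) (v x) ⟩
    u x ∎

  entry : ∀ {x y} → x ≢ y →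
    adj (localComplement X₁ (punchIn b a)) (embed (2 + k) x) (embed (2 + k) y) ≡ adj G x y
  entry {x} {y} x≢y = begin
    adj (localComplement X₁ (punchIn b a)) (embed (2 + k) x) (embed (2 + k) y)
      ≡⟨ localComplement-≢ X₁ (punchIn b a) (x≢y ∘ embed-injective (2 + k)) ⟩
    adj X₁ (embed (2 + k) x) (embed (2 + k) y) xor
      (adj X₁ (punchIn b a) (embed (2 + k) x) ∧ adj X₁ (punchIn b a) (embed (2 + k) y))
      ≡⟨ cong₂ _xor_ (addAncilla-≢ b X₂ ŵ (x≢y ∘ embed-injective (suc k))) (cong₂ _∧_ (row x) (row y)) ⟩
    (adj X₂ (embed (suc k) x) (embed (suc k) y) xor (ŵ (embed (suc k) x) ∧ ŵ (embed (suc k) y)))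
      xor (u x ∧ u y)
      ≡⟨ cong (_xor (u x ∧ u y)) (cong₂ _xor_ (addAncilla-≢ a Ĝ v̂ (x≢y ∘ embed-injective k))
                                             (cong₂ _∧_ (ŵ-old x) (ŵ-old y))) ⟩
    ((adj Ĝ (embed k x) (embed k y) xor (v̂ (embed k x) ∧ v̂ (embed k y)))
      xor (u+v x ∧ u+v y)) xor (u x ∧ u y)
      ≡⟨ cong (λ c → (c xor (u+v x ∧ u+v y)) xor (u x ∧ u y))
           (cong₂ _xor_ (adj≡ e₁ x y) (cong₂ _∧_ (padding-embed k v x) (padding-embed k v y))) ⟩
    ((adj G₁ x y xor (v x ∧ v y)) xor ((u x xor v x) ∧ (u y xor v y))) xor (u x ∧ u y)
      ≡⟨ solve 5 (λ g p q p′ q′ → ((g :+ q :* q′) :+ (p :+ q) :* (p′ :+ q′)) :+ p :* p′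
                               := g :+ (p :* q′ :+ q :* p′)) refl (adj G₁ x y) (u x) (v x) (u y) (v y) ⟩
    adj G₁ x y xor ((u x ∧ v y) xor (v x ∧ u y))
      ≡⟨ e x≢y ⟨
    adj G x y ∎

-- Symmetric elimination

sum-xor-∧ : ∀ {n} (c f g : Fin n → Bool) b →
  sum (λ j → c j ∧ (f j xor (b ∧ g j))) ≡ sum (λ j → c j ∧ f j) xor (b ∧ sum (λ j → c j ∧ g j))
sum-xor-∧ c f g b = begin
  sum (λ j → c j ∧ (f j xor (b ∧ g j)))
    ≡⟨ sum-cong-≗ (λ j → solve 4 (λ x y z t → x :* (y :+ t :* z) := x :* y :+ t :* (x :* z))
                       refl (c j) (f j) (g j) b) ⟩
  sum (λ j → (c j ∧ f j) xor (b ∧ (c j ∧ g j)))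
    ≡⟨ ∑-distrib-+ (λ j → c j ∧ f j) (λ j → b ∧ (c j ∧ g j)) ⟩
  sum (λ j → c j ∧ f j) xor sum (λ j → b ∧ (c j ∧ g j))
    ≡⟨ cong (sum (λ j → c j ∧ f j) xor_) (*-distribˡ-sum b (λ j → c j ∧ g j)) ⟨
  sum (λ j → c j ∧ f j) xor (b ∧ sum (λ j → c j ∧ g j)) ∎
  where open ≡-Reasoning
        open xor-∧-Solver

-- Otherwise the unit vector at `x` would be a nontrivial relation supported on `S`.
independent⇒∌zero : ∀ {m n} {M : Matrix m n} {S} x → IndependentColumns M S →
                    (∀ i → M i x ≡ false) → lookup S x ≡ false
independent⇒∌zero {M = M} {S} x ind zeros with lookup S x in Sx
... | false = refl
... | true  = contradiction (trans (sym (ind (δ x) supp ker x)) (δ-refl x)) false≢true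
  where
  supp : ∀ j → j ∉ S → δ x j ≡ false
  supp j j∉S = δ-≢ {a = x} {j} λ { refl → false≢true (trans (sym (∉⇒lookup j∉S)) Sx) }

  ker : ∀ i → sum (λ j → δ x j ∧ M i j) ≡ false
  ker i = trans (sum-cong-≗ λ j → ∧-comm (δ x j) (M i j)) (trans (sum-δ (M i) x) (zeros i))

-- Since the columns in `R` are zero, overwriting `c` by zero on `R` preserves all relations. Here
-- `R` is the set of pivots, on which `c` may be nonzero.
independent-outside : ∀ {m n} {M′ : Matrix m n} {S} (R : Fin n → Bool) → IndependentColumns M′ S →
  (∀ i j → R j ≡ true → M′ i j ≡ false) →
  (c : Fin n → Bool) → (∀ j → R j ≡ false → j ∉ S → c j ≡ false) →
  (∀ i → sum (λ j → c j ∧ M′ i j) ≡ false) → ∀ j → R j ≡ false → c j ≡ false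
independent-outside {M′ = M′} {S} R ind zeros c supp ker j Rj =
  trans (sym (kept Rj)) (ind c₀ supp₀ ker₀ j)
  where
  c₀ : Fin _ → Bool
  c₀ i = not (R i) ∧ c i

  kept : ∀ {i} → R i ≡ false → c₀ i ≡ c i
  kept {i} Ri = cong (λ b → not b ∧ c i) Ri

  supp₀ : ∀ i → i ∉ S → c₀ i ≡ false
  supp₀ i i∉S with R i in Ri
  ... | true  = refl
  ... | false = supp i Ri i∉S

  term : ∀ i j → c₀ j ∧ M′ i j ≡ c j ∧ M′ i j
  term i j with R j in Rj
  ... | false = refl
  ... | true  = sym (trans (cong (c j ∧_) (zeros i j Rj)) (∧-zeroʳ (c j)))

  ker₀ : ∀ i → sum (λ j → c₀ j ∧ M′ i j) ≡ false
  ker₀ i = trans (sum-cong-≗ (term i)) (ker i)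

IsSymmetric : ∀ {n} → Matrix n n → Set
IsSymmetric M = ∀ x y → M x y ≡ M y x

module SquarePivot {n} (M : Matrix n n) (M-sym : IsSymmetric M) x (Mxx : M x x ≡ true) where

  -- The Schur complement of the entry at `(x , x)`, kept at full size: row and column `x` become
  -- zero.
  M′ : Matrix n n
  M′ i j = M i j xor (M x i ∧ M x j)

  M′-sym : IsSymmetric M′
  M′-sym i j = cong₂ _xor_ (M-sym i j) (∧-comm (M x i) (M x j))

  zeros : ∀ i → M′ i x ≡ false
  zeros i rewrite Mxx | M-sym i x | ∧-identityʳ (M x i) = xor-same (M x i)

  -- Rows of `M′` are sums of rows of `M`, so a relation between columns of `M` holds in `M′` too
  -- and has zero coefficients off `x`. Row `x` of `M` then forces the coefficient at `x` to vanish.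
  insert-pivot : ∀ {r} → IndependentSize M′ r → IndependentSize M (suc r)
  insert-pivot (S , ind , refl) = S [ x ]≔ inside , ind⁺ , ∣insert∣ S x x∉S
    where
    x∉S = independent⇒∌zero x ind zeros

    ind⁺ : IndependentColumns M (S [ x ]≔ inside)
    ind⁺ c supp ker = c≡0
      where
      c≡0-off : ∀ j → δ x j ≡ false → c j ≡ false
      c≡0-off = independent-outside (δ x) ind zeros′ c supp′ ker′
        where
        zeros′ : ∀ i j → δ x j ≡ true → M′ i j ≡ false
        zeros′ i j e with j ≟ x
        ... | yes refl = zeros i
        supp′ : ∀ j → δ x j ≡ false → j ∉ S → c j ≡ false
        supp′ j e j∉S with j ≟ x
        ... | no j≢x = supp j (lookup⇒∉ (trans (lookup∘update′ j≢x S inside) (∉⇒lookup j∉S)))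
        ker′ : ∀ i → sum (λ j → c j ∧ M′ i j) ≡ false
        ker′ i = trans (sum-xor-∧ c (M i) (M x) (M x i))
          (cong₂ _xor_ (ker i) (trans (cong (M x i ∧_) (ker x)) (∧-zeroʳ (M x i))))

      c≡0 : ∀ j → c j ≡ false
      c≡0 j with j ≟ x
      ... | no j≢x   = c≡0-off j (δ-≢ j≢x)
      ... | yes refl = begin
        c x                       ≡⟨ ∧-identityʳ (c x) ⟨
        c x ∧ true                ≡⟨ cong (c x ∧_) Mxx ⟨
        c x ∧ M x x               ≡⟨ sum-single x (λ j j≢x → cong (_∧ M x j) (c≡0-off j (δ-≢ j≢x))) ⟨
        sum (λ j → c j ∧ M x j)   ≡⟨ ker x ⟩
        false                     ∎
        where open ≡-Reasoning

module HyperbolicPivot {n} (M : Matrix n n) (M-sym : IsSymmetric M) x y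
         (Mxx : M x x ≡ false) (Myy : M y y ≡ false) (Mxy : M x y ≡ true) where

  Myx : M y x ≡ true
  Myx = trans (M-sym y x) Mxy

  y≢x : y ≢ x
  y≢x refl = false≢true (trans (sym Mxx) Mxy)

  -- The Schur complement of the block on `x` and `y`, which has zero diagonal and is its own
  -- inverse.
  M′ : Matrix n n
  M′ i j = (M i j xor (M x i ∧ M y j)) xor (M y i ∧ M x j)

  M′-sym : IsSymmetric M′
  M′-sym i j rewrite M-sym i j = solve 5 (λ m a b c d → (m :+ a :* b) :+ c :* d := (m :+ d :* c) :+ b :* a)
    refl (M j i) (M x i) (M y j) (M y i) (M x j)
    where open xor-∧-Solver

  zerosˣ : ∀ i → M′ i x ≡ false
  zerosˣ i rewrite Mxx | Myx | M-sym i x =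
    solve 2 (λ a b → (a :+ a :* con true) :+ b :* con false := con false) refl (M x i) (M y i)
    where open xor-∧-Solver

  zerosʸ : ∀ i → M′ i y ≡ false
  zerosʸ i rewrite Mxy | Myy | M-sym i y =
    solve 2 (λ a b → (b :+ a :* con false) :+ b :* con true := con false) refl (M x i) (M y i)
    where open xor-∧-Solver

  -- As for a square pivot, a relation has zero coefficients off `x` and `y`. Because the diagonal
  -- of the block is zero, row `y` then isolates `c x` and row `x` isolates `c y`.
  insert-pivots : ∀ {r} → IndependentSize M′ r → IndependentSize M (2 + r)
  insert-pivots (S , ind , refl) = (S [ x ]≔ inside) [ y ]≔ inside , ind⁺ ,
    trans (∣insert∣ (S [ x ]≔ inside) y (trans (lookup∘update′ y≢x S inside) y∉S))
          (cong suc (∣insert∣ S x x∉S))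
    where
    x∉S = independent⇒∌zero x ind zerosˣ
    y∉S = independent⇒∌zero y ind zerosʸ

    ind⁺ : IndependentColumns M ((S [ x ]≔ inside) [ y ]≔ inside)
    ind⁺ c supp ker = c≡0
      where
      c≡0-off : ∀ {j} → j ≢ x → j ≢ y → c j ≡ false
      c≡0-off {j} j≢x j≢y = independent-outside (λ j → δ x j ∨ δ y j) ind zeros′ c supp′ ker′ j
        (cong₂ _∨_ (δ-≢ j≢x) (δ-≢ j≢y))
        where
        zeros′ : ∀ i j → δ x j ∨ δ y j ≡ true → M′ i j ≡ false
        zeros′ i j e with j ≟ x | j ≟ y
        ... | yes refl | _        = zerosˣ i
        ... | no _     | yes refl = zerosʸ i
        supp′ : ∀ j → δ x j ∨ δ y j ≡ false → j ∉ S → c j ≡ false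
        supp′ j e j∉S with j ≟ x | j ≟ y
        ... | no j≢x | no j≢y = supp j (lookup⇒∉
          (trans (lookup∘update′ j≢y (S [ x ]≔ inside) inside)
                 (trans (lookup∘update′ j≢x S inside) (∉⇒lookup j∉S))))
        ker′ : ∀ i → sum (λ j → c j ∧ M′ i j) ≡ false
        ker′ i = trans (sum-xor-∧ c (λ j → M i j xor (M x i ∧ M y j)) (M x) (M y i))
          (cong₂ _xor_
            (trans (sum-xor-∧ c (M i) (M y) (M x i))
                   (cong₂ _xor_ (ker i) (trans (cong (M x i ∧_) (ker y)) (∧-zeroʳ (M x i)))))
            (trans (cong (M y i ∧_) (ker x)) (∧-zeroʳ (M y i))))

      read-off : ∀ a b → M b a ≡ true → (∀ j → j ≢ a → c j ∧ M b j ≡ false) → c a ≡ false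
      read-off a b Mba others = begin
        c a                       ≡⟨ ∧-identityʳ (c a) ⟨
        c a ∧ true                ≡⟨ cong (c a ∧_) Mba ⟨
        c a ∧ M b a               ≡⟨ sum-single a others ⟨
        sum (λ j → c j ∧ M b j)   ≡⟨ ker b ⟩
        false                     ∎
        where open ≡-Reasoning

      othersˣ : ∀ j → j ≢ x → c j ∧ M y j ≡ false
      othersˣ j j≢x with j ≟ y
      ... | yes refl = trans (cong (c y ∧_) Myy) (∧-zeroʳ (c y))
      ... | no j≢y   = cong (_∧ M y j) (c≡0-off j≢x j≢y)

      othersʸ : ∀ j → j ≢ y → c j ∧ M x j ≡ false
      othersʸ j j≢y with j ≟ x
      ... | yes refl = trans (cong (c x ∧_) Mxx) (∧-zeroʳ (c x))
      ... | no j≢x   = cong (_∧ M x j) (c≡0-off j≢x j≢y)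

      c≡0 : ∀ j → c j ≡ false
      c≡0 j with j ≟ x | j ≟ y
      ... | yes refl | _        = read-off x y Myx othersˣ
      ... | no _     | yes refl = read-off y x Mxy othersʸ
      ... | no j≢x   | no j≢y   = c≡0-off j≢x j≢y

addMatrix : ∀ {n} → Graph n → (K : Matrix n n) → IsSymmetric K → Graph n
addMatrix G K K-sym .adj x y     = adj G x y xor (not (does (x ≟ y)) ∧ K x y)
addMatrix G K K-sym .adj-sym x y =
  cong₂ _xor_ (adj-sym G x y) (cong₂ (λ b c → not b ∧ c) (does-≟-sym x y) (K-sym x y))
addMatrix G K K-sym .irrefl x rewrite irrefl G x | dec-true (x ≟ x) refl = refl

addMatrix-≢ : ∀ {n} (G : Graph n) K K-sym {x y} → x ≢ y →
              adj (addMatrix G K K-sym) x y ≡ adj G x y xor K x y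
addMatrix-≢ G K K-sym {x} {y} x≢y rewrite dec-false (x ≟ y) x≢y = refl

module _ {n} (G : Graph n) (K : Matrix n n) (K-sym : IsSymmetric K) where

  addMatrix-cancel : ∀ {x y} → x ≢ y → adj G x y ≡ adj (addMatrix G K K-sym) x y xor K x y
  addMatrix-cancel {x} {y} x≢y = trans
    (solve 2 (λ g k → g := (g :+ k) :+ k) refl (adj G x y) (K x y))
    (cong (_xor K x y) (sym (addMatrix-≢ G K K-sym x≢y)))
    where open xor-∧-Solver

  addMatrix-difference : ∀ {G′ : Graph n} {M : Matrix n n} →
    (∀ {x y} → x ≢ y → adj G x y xor adj G′ x y ≡ M x y) →
    ∀ {x y} → x ≢ y → adj (addMatrix G K K-sym) x y xor adj G′ x y ≡ M x y xor K x y
  addMatrix-difference {G′} e {x} {y} x≢y = trans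
    (cong (_xor adj G′ x y) (addMatrix-≢ G K K-sym x≢y))
    (trans (solve 3 (λ g k g′ → (g :+ k) :+ g′ := (g :+ g′) :+ k) refl (adj G x y) (K x y) (adj G′ x y))
           (cong (_xor K x y) (e x≢y)))
    where open xor-∧-Solver

independent-∅ : ∀ {m n} (M : Matrix m n) → IndependentSize M 0
independent-∅ {n = n} M = ⊥ , (λ c supp _ j → supp j ∉⊥) , ∣⊥∣≡0 n

-- The bound b on the number of pivots is the fuel of the recursion; it is
-- exhausted only if M has b independent columns.
Eliminated : ∀ {n} → ℕ → Matrix n n → Graph n → Graph n → Set
Eliminated b M G G′ =
  (∃[ s ] (Realizable s G G′ × IndependentSize M s)) ⊎ (∃[ s ] (b ≤ s × IndependentSize M s))

-- A step uses one unit of fuel and inserts `suc j` pivots: one for a square, two for a hyperbolic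
-- plane.
Eliminated-step : ∀ j {b n} {M M₁ : Matrix n n} {G G₁ G′} →
  (∀ {s} → Realizable s G₁ G′ → Realizable (suc j + s) G G′) →
  (∀ {s} → IndependentSize M₁ s → IndependentSize M (suc j + s)) →
  Eliminated b M₁ G₁ G′ → Eliminated (suc b) M G G′
Eliminated-step j realize insert (inj₁ (s , real , size)) = inj₁ (suc j + s , realize real , insert size)
Eliminated-step j realize insert (inj₂ (s , b≤s , size))  =
  inj₂ (suc j + s , s≤s (≤-trans b≤s (ℕ.m≤n+m s j)) , insert size)

-- A nonzero diagonal entry yields a square. Without one the matrix is alternating, and any nonzero
-- entry yields a hyperbolic plane. Adding the same summand to `M` and to `G` preserves the
-- hypothesis, and for zero `M` the two graphs agree.
symmetricElimination : ∀ b {n} (M : Matrix n n) → IsSymmetric M → {G G′ : Graph n} →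
  (∀ {x y} → x ≢ y → adj G x y xor adj G′ x y ≡ M x y) → Eliminated b M G G′
symmetricElimination zero M M-sym e = inj₂ (0 , z≤n , independent-∅ M)
symmetricElimination (suc b) {n} M M-sym {G} {G′} e =
  pivot (any? λ x → M x x Bool.≟ true) (any? λ x → any? λ y → M x y Bool.≟ true)
  where
  xor-false : ∀ a c → a xor c ≡ false → a ≡ c
  xor-false false c     eq = sym eq
  xor-false true  true  _  = refl

  square : ∀ x → M x x ≡ true → Eliminated (suc b) M G G′
  square x Mxx = Eliminated-step 0
    (realize-square {G = G} {G₁} (M x) (addMatrix-cancel G K K-sym)) insert-pivot
    (symmetricElimination b M′ M′-sym (addMatrix-difference G K K-sym {G′} {M} e))
    where
    open SquarePivot M M-sym x Mxx

    K : Matrix n n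
    K i j = M x i ∧ M x j

    K-sym : IsSymmetric K
    K-sym i j = ∧-comm (M x i) (M x j)

    G₁ = addMatrix G K K-sym

  hyperbolic : ∀ x y → M x x ≡ false → M y y ≡ false → M x y ≡ true → Eliminated (suc b) M G G′
  hyperbolic x y Mxx Myy Mxy = Eliminated-step 1
    (realize-hyperbolic {G = G} {G₁} (M x) (M y) (addMatrix-cancel G K K-sym)) insert-pivots
    (symmetricElimination b M′ M′-sym λ {i} {j} i≢j →
      trans (addMatrix-difference G K K-sym {G′} {M} e i≢j)
            (sym (xor-assoc (M i j) (M x i ∧ M y j) (M y i ∧ M x j))))
    where
    open HyperbolicPivot M M-sym x y Mxx Myy Mxy

    K : Matrix n n
    K i j = (M x i ∧ M y j) xor (M y i ∧ M x j)

    K-sym : IsSymmetric K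
    K-sym i j = solve 4 (λ p q p′ q′ → p :* q′ :+ q :* p′ := p′ :* q :+ q′ :* p)
                  refl (M x i) (M y i) (M x j) (M y j)
      where open xor-∧-Solver

    G₁ = addMatrix G K K-sym

  pivot : Dec (∃[ x ] M x x ≡ true) → Dec (∃[ x ] ∃[ y ] M x y ≡ true) → Eliminated (suc b) M G G′
  pivot (yes (x , Mxx)) _ = square x Mxx
  pivot (no alternating) (yes (x , y , Mxy)) = hyperbolic x y
    (¬-not λ Mxx → alternating (x , Mxx)) (¬-not λ Myy → alternating (y , Myy)) Mxy
  pivot (no _) (no zeros) = inj₁ (0 , (G′ , graph-ext G′≡G , same (λ _ → refl) (λ _ _ → refl)) ,
                                  independent-∅ M)
    where
    G′≡G : ∀ {x y} → x ≢ y → adj G′ x y ≡ adj G x y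
    G′≡G {x} {y} x≢y = sym (xor-false (adj G x y) (adj G′ x y)
      (trans (e x≢y) (¬-not λ Mxy → zeros (x , y , Mxy))))

minimumRank⇒ancillaDistance : ∀ {n k} {G G′ : Graph n} →
  MinimumRank≤ k (G ⊕ G′) → AncillaDistance≤ k G G′
minimumRank⇒ancillaDistance {G = G} {G′} (r , ((d , _ , max) , _) , r≤k) =
  -- The filled matrix has rank `r`, so it cannot have `suc r` independent columns and this fuel is
  -- never exhausted.
  conclude (symmetricElimination (suc r) M M-sym off-diagonal)
  where
  M = fillDiagonal (G ⊕ G′) d

  M-sym : IsSymmetric M
  M-sym x y with x ≟ y | y ≟ x
  ... | yes refl | yes _  = refl
  ... | yes refl | no y≢x = contradiction refl y≢x
  ... | no x≢y   | yes e  = contradiction (sym e) x≢y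
  ... | no _     | no _   = adj-sym (G ⊕ G′) x y

  off-diagonal : ∀ {x y} → x ≢ y → adj G x y xor adj G′ x y ≡ M x y
  off-diagonal {x} {y} x≢y rewrite dec-false (x ≟ y) x≢y = refl

  conclude : Eliminated (suc r) M G G′ → AncillaDistance≤ _ G G′
  conclude (inj₁ (s , (Ĝ , e , vm) , size)) =
    let d , min , d≤s = minimum (commonAncestor? G G′) (embed⇒↑ˡ s (Ĝ , induced⇒VertexMinor s e , vm))
    in d , min , ≤-trans d≤s (≤-trans (max s size) r≤k)
  conclude (inj₂ (s , r<s , size)) = contradiction (max s size) (ℕ.<⇒≱ r<s)

-- Local equivalence

-- The Paulis I, X, Z, Y are (0,0), (1,0), (0,1), (1,1); signs are ignored.
Pauli : Set
Pauli = Bool × Bool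

-- The stabilizer group of the graph state up to signs. Its generators are X at a vertex times Z at
-- the neighbours, so the Z-part is the adjacency matrix applied to the X-part.
Stabilizes : ∀ {n} → Graph n → (Fin n → Pauli) → Set
Stabilizes G ℓ = ∀ x → proj₂ (ℓ x) ≡ sum (λ y → adj G x y ∧ proj₁ (ℓ y))

open Inverse using (to; from; strictlyInverseˡ; strictlyInverseʳ)

-- Equivalence of the stabilizer groups under one-qubit Clifford gates; a
-- bijection of Pauli that fixes the identity is automatically linear.
infix 4 _≅_

record _≅_ {n} (G H : Graph n) : Set where
  field
    clifford : Fin n → Pauli ↔ Pauli
    fix-I    : ∀ x → to (clifford x) (false , false) ≡ (false , false)
    forth    : ∀ {ℓ} → Stabilizes G ℓ → Stabilizes H (λ x → to (clifford x) (ℓ x))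
    back     : ∀ {ℓ} → Stabilizes H ℓ → Stabilizes G (λ x → from (clifford x) (ℓ x))

  fix-I⁻¹ : ∀ x → from (clifford x) (false , false) ≡ (false , false)
  fix-I⁻¹ x = trans (cong (from (clifford x)) (sym (fix-I x))) (strictlyInverseʳ (clifford x) _)

open _≅_

Stabilizes-resp : ∀ {n} {G H : Graph n} → G ≈ H → ∀ {ℓ} → Stabilizes G ℓ → Stabilizes H ℓ
Stabilizes-resp e {ℓ} st x = trans (st x) (sum-cong-≗ λ y → cong (_∧ proj₁ (ℓ y)) (adj≡ e x y))

Stabilizes-cong : ∀ {n} {G : Graph n} {ℓ ℓ′} → ℓ ≗ ℓ′ → Stabilizes G ℓ → Stabilizes G ℓ′
Stabilizes-cong {G = G} e st x = trans (cong proj₂ (sym (e x)))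
  (trans (st x) (sum-cong-≗ λ y → cong (λ a → adj G x y ∧ proj₁ a) (e y)))

≈⇒≅ : ∀ {n} {G H : Graph n} → G ≈ H → G ≅ H
≈⇒≅ e .clifford _ = ↔-refl
≈⇒≅ e .fix-I _    = refl
≈⇒≅ e .forth {ℓ}  = Stabilizes-resp e {ℓ}
≈⇒≅ e .back  {ℓ}  = Stabilizes-resp (≈-sym e) {ℓ}

≅-sym : ∀ {n} {G H : Graph n} → G ≅ H → H ≅ G
≅-sym e .clifford x = ↔-sym (clifford e x)
≅-sym e .fix-I      = fix-I⁻¹ e
≅-sym e .forth      = back e
≅-sym e .back       = forth e

≅-trans : ∀ {n} {G H K : Graph n} → G ≅ H → H ≅ K → G ≅ K
≅-trans e f .clifford x = ↔-trans (clifford e x) (clifford f x)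
≅-trans e f .fix-I x    = trans (cong (to (clifford f x)) (fix-I e x)) (fix-I f x)
≅-trans e f .forth st   = forth f (forth e st)
≅-trans e f .back st    = back e (back f st)

-- X ↦ X, Z ↦ Y at the complemented vertex and X ↦ Y, Z ↦ Z at its neighbours.
shear : Bool → Bool → Pauli → Pauli
shear true  _ (p , q) = p xor q , q
shear false e (p , q) = p , q xor (e ∧ p)

shear-involutive : ∀ d e a → shear d e (shear d e a) ≡ a
shear-involutive true  e (p , q) = cong (_, q) (solve 2 (λ p q → (p :+ q) :+ q := p) refl p q)
  where open xor-∧-Solver
shear-involutive false e (p , q) = cong (p ,_) (solve 2 (λ q r → (q :+ r) :+ r := q) refl q (e ∧ p))
  where open xor-∧-Solver

module _ {n} (G : Graph n) (v : Fin n) where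

  private
    N : Fin n → Bool
    N = adj G v

  localShear : (Fin n → Pauli) → Fin n → Pauli
  localShear ℓ x = shear (δ v x) (N x) (ℓ x)

  localShear-Stabilizes : ∀ {ℓ} → Stabilizes G ℓ → Stabilizes (localComplement G v) (localShear ℓ)
  localShear-Stabilizes {ℓ} st x = begin
    proj₂ (localShear ℓ x)
      ≡⟨ z-part ⟩
    q x xor (N x ∧ p x)
      -- The term `N x ∧ q v` enters twice: as the effect of the changed adjacencies, by the
      -- equation at `v`, and as the effect of the X-part gained at `v`. The term `N x ∧ p x` is the
      -- diagonal entry that local complementation leaves out.
      ≡⟨ solve 3 (λ a b c → a :+ c := (a :+ b) :+ (b :+ c)) refl (q x) (N x ∧ q v) (N x ∧ p x) ⟩
    (q x xor (N x ∧ q v)) xor ((N x ∧ q v) xor (N x ∧ p x))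
      ≡⟨ cong₂ _xor_ (cong₂ _xor_ (st x) (trans (cong (N x ∧_) (st v)) (*-distribˡ-sum (N x) (λ y → N y ∧ p y))))
                     (cong₂ _xor_ (sym (trans (sum-δ (λ y → adj G x y ∧ q v) v) (cong (_∧ q v) (adj-sym G x v))))
                                  (sym (trans (sum-δ (λ y → N x ∧ (N y ∧ p y)) x) idem))) ⟩
    (sum (λ y → adj G x y ∧ p y) xor sum (λ y → N x ∧ (N y ∧ p y))) xor
    (sum (λ y → (adj G x y ∧ q v) ∧ δ v y) xor sum (λ y → (N x ∧ (N y ∧ p y)) ∧ δ x y))
      ≡⟨ cong₂ _xor_ (∑-distrib-+ (λ y → adj G x y ∧ p y) (λ y → N x ∧ (N y ∧ p y)))
                     (∑-distrib-+ (λ y → (adj G x y ∧ q v) ∧ δ v y) (λ y → (N x ∧ (N y ∧ p y)) ∧ δ x y)) ⟨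
    sum (λ y → (adj G x y ∧ p y) xor (N x ∧ (N y ∧ p y))) xor
    sum (λ y → ((adj G x y ∧ q v) ∧ δ v y) xor ((N x ∧ (N y ∧ p y)) ∧ δ x y))
      ≡⟨ ∑-distrib-+ (λ y → (adj G x y ∧ p y) xor (N x ∧ (N y ∧ p y))) _ ⟨
    sum (λ y → ((adj G x y ∧ p y) xor (N x ∧ (N y ∧ p y))) xor
               (((adj G x y ∧ q v) ∧ δ v y) xor ((N x ∧ (N y ∧ p y)) ∧ δ x y)))
      ≡⟨ sum-cong-≗ term ⟨
    sum (λ y → adj (localComplement G v) x y ∧ proj₁ (localShear ℓ y)) ∎
    where
    open ≡-Reasoning
    open xor-∧-Solver

    p q : Fin n → Bool
    p y = proj₁ (ℓ y)
    q y = proj₂ (ℓ y)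

    idem : N x ∧ (N x ∧ p x) ≡ N x ∧ p x
    idem = trans (sym (∧-assoc (N x) (N x) (p x))) (cong (_∧ p x) (∧-idem (N x)))

    z-part : proj₂ (localShear ℓ x) ≡ q x xor (N x ∧ p x)
    z-part with x ≟ v
    ... | no _     = refl
    ... | yes refl = sym (trans (cong (λ b → q v xor (b ∧ p v)) (irrefl G v)) (xor-identityʳ (q v)))

    term : ∀ y → adj (localComplement G v) x y ∧ proj₁ (localShear ℓ y) ≡
                 ((adj G x y ∧ p y) xor (N x ∧ (N y ∧ p y))) xor
                 (((adj G x y ∧ q v) ∧ δ v y) xor ((N x ∧ (N y ∧ p y)) ∧ δ x y))
    term y rewrite does-≟-sym x y with y ≟ v
    ... | yes refl rewrite irrefl G y =
      solve 5 (λ a d n p q → (a :+ (con true :+ d) :* (n :* con false)) :* (p :+ q) :=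
                             (a :* p :+ n :* (con false :* p)) :+
                             ((a :* q) :* con true :+ (n :* (con false :* p)) :* d))
        refl (adj G x y) (δ x y) (N x) (p y) (q y)
    ... | no _ =
      solve 6 (λ a d n m p q → (a :+ (con true :+ d) :* (n :* m)) :* p :=
                               (a :* p :+ n :* (m :* p)) :+ ((a :* q) :* con false :+ (n :* (m :* p)) :* d))
        refl (adj G x y) (δ x y) (N x) (N y) (p y) (q v)

localComplement-≅ : ∀ {n} (G : Graph n) v → G ≅ localComplement G v
localComplement-≅ G v .clifford x = mk↔ₛ′ f f involutive involutive
  where
  f = shear (δ v x) (adj G v x)
  involutive = shear-involutive (δ v x) (adj G v x)
localComplement-≅ G v .fix-I x with δ v x | adj G v x
... | true  | _     = refl
... | false | true  = refl
... | false | false = refl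
localComplement-≅ G v .forth {ℓ} = localShear-Stabilizes G v {ℓ}
-- Complementing at `v` keeps the neighbourhood of `v`, so both graphs have the same shears, which
-- are involutions.
localComplement-≅ G v .back {ℓ} st = Stabilizes-cong {G = G}
  (λ x → cong (λ b → shear (δ v x) b (ℓ x)) (localComplement-row G v x))
  (Stabilizes-resp (localComplement-involutive G v) {localShear (localComplement G v) v ℓ}
    (localShear-Stabilizes (localComplement G v) v st))

Star⇒≅ : ∀ {n} {G H : Graph n} → Star Step G H → G ≅ H
Star⇒≅ ε              = ≈⇒≅ ≈-refl
Star⇒≅ ((v , e) ◅ es) = ≅-trans (≅-trans (localComplement-≅ _ v) (≈⇒≅ e)) (Star⇒≅ es)

-- The equation at a vertex involves only its neighbours, which lie on the same side of `C`.
Stabilizes-restrict : ∀ {n} {G : Graph n} {ℓ} (C : Fin n → Bool) →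
  (∀ {x y} → adj G x y ≡ true → C x ≡ C y) → Stabilizes G ℓ →
  Stabilizes G (λ x → if C x then ℓ x else (false , false))
Stabilizes-restrict {G = G} {ℓ} C closed st x with C x in Cx
... | true  = trans (st x) (sum-cong-≗ term)
  where
  term : ∀ y → adj G x y ∧ proj₁ (ℓ y) ≡ adj G x y ∧ proj₁ (if C y then ℓ y else (false , false))
  term y with adj G x y in xy
  ... | false = refl
  ... | true rewrite trans (sym (closed xy)) Cx = refl
... | false = sym (sum-false term)
  where
  term : ∀ y → adj G x y ∧ proj₁ (if C y then ℓ y else (false , false)) ≡ false
  term y with adj G x y in xy
  ... | false = refl
  ... | true rewrite trans (sym (closed xy)) Cx = refl

-- Cutting a stabilizer of H down to a component of H gives a stabilizer.
-- Applied to the image of the stabilizer of G generated at x, this shows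
-- that the latter is supported on the component of x in H.
≅⇒Connected : ∀ {n} {G H : Graph n} → G ≅ H → ∀ {x y} → adj G x y ≡ true → Connected H x y
≅⇒Connected {n} {G} {H} e {x} {y} xy with connected? H x y
... | yes x~y = x~y
... | no ¬x~y = contradiction contra false≢true
  where
  C : Fin n → Bool
  C u = does (connected? H x u)

  closed : ∀ {u w} → adj H u w ≡ true → C u ≡ C w
  closed {u} {w} uw = does-⇔ (mk⇔ (_◅◅ (uw ◅ ε)) (_◅◅ (trans (adj-sym H w u) uw ◅ ε)))
    (connected? H x u) (connected? H x w)

  ℓ ℓ′ : Fin n → Pauli
  ℓ u  = δ x u , adj G u x
  ℓ′ u = from (clifford e u) (if C u then to (clifford e u) (ℓ u) else (false , false))

  ℓ′-Stabilizes : Stabilizes G ℓ′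
  ℓ′-Stabilizes = back e (Stabilizes-restrict {G = H} C closed
    (forth e {ℓ} λ u → sym (sum-δ (adj G u) x)))

  -- The only nonzero X-part of `ℓ` is at `x`, which survives the cut.
  x-part : ∀ u → proj₁ (ℓ′ u) ≡ δ x u
  x-part u = cut (connected? H x u)
    where
    cut : (d : Dec (Connected H x u)) →
      proj₁ (from (clifford e u) (if does d then to (clifford e u) (ℓ u) else (false , false))) ≡ δ x u
    cut (yes _)   = cong proj₁ (strictlyInverseʳ (clifford e u) (ℓ u))
    cut (no ¬x~u) = trans (cong proj₁ (fix-I⁻¹ e u)) (sym (δ-≢ {a = x} {u} λ { refl → ¬x~u ε }))

  -- Outside `C` the cut stabilizer is trivial at `y`, yet its X-part `δ x` forces the Z-part
  -- `adj G y x` there.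
  contra : false ≡ true
  contra = begin
    false
      ≡⟨ cong proj₂ (fix-I⁻¹ e y) ⟨
    proj₂ (from (clifford e y) (false , false))
      ≡⟨ cong (λ b → proj₂ (from (clifford e y) (if b then to (clifford e y) (ℓ y) else (false , false))))
              (dec-false (connected? H x y) ¬x~y) ⟨
    proj₂ (ℓ′ y)
      ≡⟨ ℓ′-Stabilizes y ⟩
    sum (λ u → adj G y u ∧ proj₁ (ℓ′ u))
      ≡⟨ sum-cong-≗ (λ u → cong (adj G y u ∧_) (x-part u)) ⟩
    sum (λ u → adj G y u ∧ δ x u)
      ≡⟨ sum-δ (adj G y) x ⟩
    adj G y x
      ≡⟨ trans (adj-sym G y x) xy ⟩
    true ∎
    where open ≡-Reasoning

-- Measuring an ancilla

sum-punchIn : ∀ {n} a (f g : Fin (suc n) → Bool) → g a ≡ false →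
  sum (λ y → f y ∧ g y) ≡ sum (λ y → f (punchIn a y) ∧ g (punchIn a y))
sum-punchIn a f g ga = trans (sum-remove {i = a} (λ y → f y ∧ g y))
  (cong (_xor sum (λ y → f (punchIn a y) ∧ g (punchIn a y)))
        (trans (cong (f a ∧_) ga) (∧-zeroʳ (f a))))

-- A stabilizer of the graph without `a` extends to one of `G` with I or Z at `a`, where `t` is
-- dictated by the equation at `a`. As `f` fixes I and Z at `a`, the image has no X-part there and
-- restricts again.
Stabilizes-delete : ∀ {n} {G H : Graph (suc n)} a (f : Fin (suc n) → Pauli → Pauli) →
  (∀ t → f a (false , t) ≡ (false , t)) →
  (∀ {ℓ} → Stabilizes G ℓ → Stabilizes H (λ x → f x (ℓ x))) →
  ∀ {ℓ} → Stabilizes (deleteVertex G a) ℓ → Stabilizes (deleteVertex H a) (λ x → f (punchIn a x) (ℓ x))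
Stabilizes-delete {n} {G} {H} a f fix f-st {ℓ} st x = begin
  proj₂ (f (punchIn a x) (ℓ x))
    ≡⟨ cong (λ b → proj₂ (f (punchIn a x) b)) (ℓ̂-old x) ⟨
  proj₂ (f (punchIn a x) (ℓ̂ (punchIn a x)))
    ≡⟨ f-st {ℓ̂} ℓ̂-st (punchIn a x) ⟩
  sum (λ y → adj H (punchIn a x) y ∧ proj₁ (f y (ℓ̂ y)))
    ≡⟨ sum-punchIn a (adj H (punchIn a x)) (λ y → proj₁ (f y (ℓ̂ y)))
         (cong proj₁ (trans (cong (f a) ℓ̂-new) (fix t))) ⟩
  sum (λ y → adj H (punchIn a x) (punchIn a y) ∧ proj₁ (f (punchIn a y) (ℓ̂ (punchIn a y))))
    ≡⟨ sum-cong-≗ (λ y → cong (λ b → adj H (punchIn a x) (punchIn a y) ∧ proj₁ (f (punchIn a y) b)) (ℓ̂-old y)) ⟩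
  sum (λ y → adj H (punchIn a x) (punchIn a y) ∧ proj₁ (f (punchIn a y) (ℓ y))) ∎
  where
  open ≡-Reasoning

  t : Bool
  t = sum (λ y → adj G a (punchIn a y) ∧ proj₁ (ℓ y))

  ℓ̂ : Fin (suc n) → Pauli
  ℓ̂ = insertAt ℓ a (false , t)

  ℓ̂-new : ℓ̂ a ≡ (false , t)
  ℓ̂-new = insertAt-lookup ℓ a (false , t)

  ℓ̂-old : ∀ y → ℓ̂ (punchIn a y) ≡ ℓ y
  ℓ̂-old = insertAt-punchIn ℓ a (false , t)

  ℓ̂-sum : ∀ z → sum (λ y → adj G z (punchIn a y) ∧ proj₁ (ℓ y)) ≡ sum (λ y → adj G z y ∧ proj₁ (ℓ̂ y))
  ℓ̂-sum z = sym (trans (sum-punchIn a (adj G z) (proj₁ ∘ ℓ̂) (cong proj₁ ℓ̂-new))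
    (sum-cong-≗ λ y → cong (λ b → adj G z (punchIn a y) ∧ proj₁ b) (ℓ̂-old y)))

  ℓ̂-st : Stabilizes G ℓ̂
  ℓ̂-st z with punchInView a z
  ... | new   = trans (cong proj₂ ℓ̂-new) (ℓ̂-sum a)
  ... | old y = trans (cong proj₂ (ℓ̂-old y)) (trans (st y) (ℓ̂-sum (punchIn a y)))

module _ {n} {G H : Graph (suc n)} (e : G ≅ H) (a : Fin (suc n)) where

  delete-Z : to (clifford e a) (false , true) ≡ (false , true) → deleteVertex G a ≅ deleteVertex H a
  delete-Z Z↦Z = record
    { clifford = λ x → clifford e (punchIn a x)
    ; fix-I    = λ x → fix-I e (punchIn a x)
    ; forth    = Stabilizes-delete {G = G} {H} a (λ x → to (clifford e x)) fix (forth e)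
    ; back     = Stabilizes-delete {G = H} {G} a (λ x → from (clifford e x)) fix⁻¹ (back e)
    }
    where
    fix : ∀ t → to (clifford e a) (false , t) ≡ (false , t)
    fix false = fix-I e a
    fix true  = Z↦Z

    fix⁻¹ : ∀ t → from (clifford e a) (false , t) ≡ (false , t)
    fix⁻¹ t = trans (cong (from (clifford e a)) (sym (fix t))) (strictlyInverseʳ (clifford e a) _)

-- Complementing at `a` exchanges Z and Y at `a`, so the composite Clifford at `a` fixes Z.
delete-Y : ∀ {n} {G H : Graph (suc n)} (e : G ≅ H) a → to (clifford e a) (true , true) ≡ (false , true) →
           deleteVertex (localComplement G a) a ≅ deleteVertex H a
delete-Y {G = G} e a Y↦Z = delete-Z (≅-trans (≅-sym (localComplement-≅ G a)) e) a
  (trans (cong (λ d → to (clifford e a) (shear d (adj G a a) (false , true))) (δ-refl a)) Y↦Z)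

-- Complementing at a neighbour `b` exchanges Y and X at `a`, which reduces the basis X to the basis
-- Y.
delete-X : ∀ {n} {G H : Graph (suc n)} (e : G ≅ H) a b → adj G b a ≡ true →
           to (clifford e a) (true , false) ≡ (false , true) →
           deleteVertex (localComplement (localComplement G b) a) a ≅ deleteVertex H a
delete-X {G = G} e a b ba X↦Z = delete-Y (≅-trans (≅-sym (localComplement-≅ G b)) e) a
  (trans (cong₂ (λ d c → to (clifford e a) (shear d c (true , true))) (δ-≢ a≢b) ba) X↦Z)
  where
  a≢b : a ≢ b
  a≢b refl = false≢true (trans (sym (irrefl G a)) ba)

-- If `a` were isolated, X at `a` alone would stabilize `G`, and its image, Z at `a` alone, would
-- stabilize `H`; but a stabilizer without X-part is trivial.
X-needs-neighbour : ∀ {n} {G H : Graph n} (e : G ≅ H) a → to (clifford e a) (true , false) ≡ (false , true) →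
                    ∃[ b ] adj G b a ≡ true
X-needs-neighbour {n} {G} {H} e a X↦Z with any? (λ b → adj G b a Bool.≟ true)
... | yes b = b
... | no isolated = contradiction contra false≢true
  where
  ℓ : Fin n → Pauli
  ℓ u = δ a u , false

  ℓ-st : Stabilizes G ℓ
  ℓ-st u = sym (trans (sum-δ (adj G u) a) (¬-not λ ua → isolated (u , ua)))

  x-part : ∀ u → proj₁ (to (clifford e u) (ℓ u)) ≡ false
  x-part u with u ≟ a
  ... | yes refl = cong proj₁ X↦Z
  ... | no _     = cong proj₁ (fix-I e u)

  contra : false ≡ true
  contra = begin
    false
      ≡⟨ sum-false (λ u → trans (cong (adj H a u ∧_) (x-part u)) (∧-zeroʳ (adj H a u))) ⟨
    sum (λ u → adj H a u ∧ proj₁ (to (clifford e u) (ℓ u)))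
      ≡⟨ forth e {ℓ} ℓ-st a ⟨
    proj₂ (to (clifford e a) (δ a a , false))
      ≡⟨ cong (λ d → proj₂ (to (clifford e a) (d , false))) (δ-refl a) ⟩
    proj₂ (to (clifford e a) (true , false))
      ≡⟨ cong proj₂ X↦Z ⟩
    true ∎
    where open ≡-Reasoning

RankTwoChange : ∀ {n} → Graph n → Graph n → Set
RankTwoChange {n} G K = ∃₂ λ (p q : Fin n → Bool) →
  ∀ {x y} → x ≢ y → adj G x y xor adj K x y ≡ (p x ∧ p y) xor (q x ∧ q y)

-- The three cases are the Pauli bases in which the ancilla a can be
-- measured.
measure : ∀ {n} {G H : Graph (suc n)} → G ≅ H → ∀ a →
          ∃[ K ] (K ≅ deleteVertex H a × RankTwoChange (deleteVertex G a) K)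
measure {n} {G} {H} e a =
  -- The preimage of Z is the Pauli to be measured at `a` in `G` when Z is measured in `H`.
  cases (from (clifford e a) (false , true)) (strictlyInverseˡ (clifford e a) (false , true))
  where
  ι = punchIn a

  open xor-∧-Solver

  cases : ∀ P → to (clifford e a) P ≡ (false , true) →
          ∃[ K ] (K ≅ deleteVertex H a × RankTwoChange (deleteVertex G a) K)
  cases (false , false) I↦Z = contradiction (cong proj₂ (trans (sym (fix-I e a)) I↦Z)) false≢true
  cases (false , true)  Z↦Z = deleteVertex G a , delete-Z e a Z↦Z ,
    (λ _ → false) , (λ _ → false) , λ {x} {y} _ → xor-same (adj G (ι x) (ι y))
  cases (true , true)   Y↦Z = deleteVertex (localComplement G a) a , delete-Y e a Y↦Z ,
    (λ x → adj G a (ι x)) , (λ _ → false) , λ {x} {y} x≢y → trans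
      (cong (adj G (ι x) (ι y) xor_) (localComplement-≢ G a (x≢y ∘ punchIn-injective a x y)))
      (solve 2 (λ g c → g :+ (g :+ c) := c :+ con false) refl (adj G (ι x) (ι y)) _)
  cases (true , false)  X↦Z with X-needs-neighbour e a X↦Z
  ... | b , ba = deleteVertex (localComplement (localComplement G b) a) a , delete-X e a b ba X↦Z ,
    -- Each complementation adds the square of its row: that of `b` in `G`, then that of `a` in the
    -- graph already complemented at `b`.
    (λ x → adj G b (ι x)) , (λ x → adj (localComplement G b) a (ι x)) , λ {x} {y} x≢y →
      let ιx≢ιy = x≢y ∘ punchIn-injective a x y in trans
      (cong (adj G (ι x) (ι y) xor_)
        (trans (localComplement-≢ (localComplement G b) a ιx≢ιy)
               (cong (_xor (adj (localComplement G b) a (ι x) ∧ adj (localComplement G b) a (ι y)))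
                     (localComplement-≢ G b ιx≢ιy))))
      (solve 3 (λ g c d → g :+ ((g :+ c) :+ d) := c :+ d) refl (adj G (ι x) (ι y))
        (adj G b (ι x) ∧ adj G b (ι y)) (adj (localComplement G b) a (ι x) ∧ adj (localComplement G b) a (ι y)))

-- Each ancilla contributes two rows to `W`; the bound is written `k * 2` because `suc k * 2`
-- computes to two further rows.
measureAll : ∀ k {n} {G H : Graph (k + n)} → G ≅ H →
  ∃[ K ] (K ≅ induced H (embed k) × ∃ λ (W : Matrix (k * 2) n) →
    ∀ {x y} → x ≢ y → adj G (embed k x) (embed k y) xor adj K x y ≡ gram W x y)
measureAll zero {G = G} e = G , e , (λ ()) , λ {x} {y} _ → xor-same (adj G x y)
measureAll (suc k) {G = G} {H} e =
  let K₁ , e₁ , p , q , change = measure e (fromℕ _)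
      K , e₂ , W , changes = measureAll k e₁
  in K , e₂ , (p ∘ embed k) ∷ᵛ (q ∘ embed k) ∷ᵛ W , λ {x} {y} x≢y →
     let x′ = embed k x
         y′ = embed k y
     in begin
       adj G (embed (suc k) x) (embed (suc k) y) xor adj K x y
         ≡⟨ solve 3 (λ g h k → g :+ k := (g :+ h) :+ (h :+ k)) refl
              (adj G (embed (suc k) x) (embed (suc k) y)) (adj K₁ x′ y′) (adj K x y) ⟩
       (adj G (embed (suc k) x) (embed (suc k) y) xor adj K₁ x′ y′) xor (adj K₁ x′ y′ xor adj K x y)
         ≡⟨ cong₂ _xor_ (change (x≢y ∘ embed-injective k)) (changes x≢y) ⟩
       ((p x′ ∧ p y′) xor (q x′ ∧ q y′)) xor gram W x y
         ≡⟨ xor-assoc (p x′ ∧ p y′) _ _ ⟩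
       (p x′ ∧ p y′) xor ((q x′ ∧ q y′) xor gram W x y) ∎
  where open ≡-Reasoning
        open xor-∧-Solver

-- `K` is locally equivalent to `G′` rather than equal to it. Having every edge of `K` inside a
-- component of `G′` suffices to compare component sizes.
ancillaDistance⇒minimumRank : ∀ {n k} {G G′ : Graph n} → AncillaDistance≤ k G G′ →
  ∃[ K ] (MinimumRank≤ (2 * k) (G ⊕ K) × (∀ {x y} → adj K x y ≡ true → Connected G′ x y))
ancillaDistance⇒minimumRank {k = k} {G} {G′} (d , (ancestor , _) , d≤k) =
  let Ĝ , vm , vm′ = ↑ˡ⇒embed d ancestor
      L , steps , L≈G = VertexMinor⇒induced vm
      L′ , steps′ , L′≈G′ = VertexMinor⇒induced vm′
      K , K≅ , W , change = measureAll d (≅-trans (≅-sym (Star⇒≅ steps)) (Star⇒≅ steps′))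
  in K ,
     gram⇒MinimumRank≤ (G ⊕ K) W
       (λ {x} {y} x≢y → trans (cong (_xor adj K x y) (sym (adj≡ L≈G x y))) (change x≢y))
       (subst (_≤ 2 * k) (ℕ.*-comm 2 d) (ℕ.*-monoʳ-≤ 2 d≤k)) ,
     ≅⇒Connected (≅-trans K≅ (≈⇒≅ L′≈G′))

-- Integrities

⊕-congʳ : ∀ {n} (G : Graph n) {H H′ : Graph n} → H ≈ H′ → G ⊕ H ≈ G ⊕ H′
⊕-congʳ G e = pointwise λ x y → cong (adj G x y xor_) (adj≡ e x y)

SizeNear : ∀ {n} → (Graph n → Set) → ℕ → Set
SizeNear Near s = ∃[ G′ ] (Near G′ × IsMaxComponentSize G′ s)

sizeNear? : ∀ {n} {Near : Graph n → Set} → (∀ {G H} → G ≈ H → Near G → Near H) →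
            (∀ G → Dec (Near G)) → ∀ s → Dec (SizeNear Near s)
sizeNear? resp near? s = anyGraph?
  (λ e (near , max) → resp e near , IsMaxComponentSize-resp e max)
  (λ G′ → near? G′ ×-dec isMaxComponentSize? G′ s)

module _ {n} (k : ℕ) (G : Graph n) where

  rankIntegrity : ∀ {s} → SizeNear (λ G′ → MinimumRank≤ k (G ⊕ G′)) s →
                  ∃[ r ] (IsRankIntegrity k G r × r ≤ s)
  rankIntegrity = minimum (sizeNear? (MinimumRank≤-resp ∘ ⊕-congʳ G) (λ G′ → minimumRank≤? k (G ⊕ G′)))

  ancillaIntegrity : ∀ {s} → SizeNear (AncillaDistance≤ k G) s →
                     ∃[ a ] (IsAncillaIntegrity k G a × a ≤ s)
  ancillaIntegrity = minimum (sizeNear? AncillaDistance≤-resp (ancillaDistance≤? k G))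

  MinimumRank≤-⊕-self : MinimumRank≤ k (G ⊕ G)
  MinimumRank≤-⊕-self = gram⇒MinimumRank≤ {0} (G ⊕ G) (λ ()) (λ {x} {y} _ → xor-same (adj G x y)) z≤n

lemma1p2 : ∀ n (G : Graph n) (k : ℕ) →
    ∃[ r₂ₖ ] ∃[ a ] ∃[ r ]
    ( IsRankIntegrity (2 * k) G r₂ₖ
    × IsAncillaIntegrity k G a
    × IsRankIntegrity k G r
    × r₂ₖ ≤ a × a ≤ r )
lemma1p2 n G k =
  -- `G` itself is a candidate, since `G ⊕ G` has no edges; this guarantees that the minimum for
  -- rank `k` exists.
  let s , size = maxComponentSize G
      r , isR@((G₁ , near₁ , size₁) , _) , _ =
        rankIntegrity k G {s} (G , MinimumRank≤-⊕-self k G , size)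
      a , isA@((G₂ , near₂ , size₂) , _) , a≤r =
        ancillaIntegrity k G {r} (G₁ , minimumRank⇒ancillaDistance near₁ , size₁)
      -- From the optimal `G₂` for ancillas comes a candidate `G₃` for rank `2 * k` whose components
      -- are no larger.
      G₃ , near₃ , edge = ancillaDistance⇒minimumRank {k = k} {G} {G₂} near₂
      s₃ , size₃ = maxComponentSize G₃
      r₂ₖ , isR₂ₖ , r₂ₖ≤s₃ = rankIntegrity (2 * k) G {s₃} (G₃ , near₃ , size₃)
  in r₂ₖ , a , r , isR₂ₖ , isA , isR ,
     ≤-trans r₂ₖ≤s₃ (maxComponentSize-mono {G = G₃} {G₂} edge size₃ size₂) , a≤r
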